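{- Let $T$ be a tree shape on $n$ nodes with a root $u_0$ such that every root-to-leaf path of $T$ contains $O(k)$ turning points. Then, in the connectivity graph model, $T$ can be grown from a single node (placed at $u_0$) in $O(k\log n)$ time steps; specifically, the process "BFS on line segments" does so: in phases $i=1,2,\dots$, for every line segment $s_i$ of $T$ at segment distance $i$ from $u_0$, with endpoints $u_{i-1}$ (closer to $u_0$) and $u_i$, it grows $s_i$ together with $u_i$ starting from $u_{i-1}$ by fast line growth, all these segments in parallel.
   Context: Shapes. Grid points are integer pairs $(x,y)$; two grid points are adjacent if they are at orthogonal (Manhattan) distance $1$. A shape $S=(V,E)$ is a finite connected graph whose nodes occupy distinct grid points and whose edges join only pairs of nodes occupying adjacent points; shapes are considered up to translation, and $n=|V|$. Growth operations. One node, the anchor $u_0$, is stationary; other nodes move relative to it, and a tree is rooted at $u_0$. A growth operation on a node $u$ toward an adjacent grid point $p$ either (i) if $u$ has no edge to $p$, creates a new node $u'$ at $p$ with edge $uu'$; or (ii) if $p$ is occupied by a node $v$ with $uv\in E$, creates a new node $u'$ at $p$, replaces edge $uv$ by edges $uu',u'v$, and translates by one unit, along the axis of $uv$, the part of the tree hanging from whichever of $u,v$ is farther from $u_0$, away from the other endpoint. In one time step a set of operations is applied concurrently, each node receiving at most one operation and all operations having the same cardinal direction; the displacement of each node is the sum of the unit vectors contributed by the operations on its path to $u_0$. The set is collision-free if no two nodes collide during these motions or end at the same point. Growth processes (connectivity graph model). A growth process from an initial shape $S_0$ performs time steps $t=1,2,\dots$, each applying a collision-free set of growth operations to the current shape;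 no edges are deleted and no edges are created other than by the operations. It grows $S$ from $S_0$ in $t_f$ time steps if the shape obtained after step $t_f$ is $S$. Turning points. A node $u$ of a path is a turning point of the path if it is an endpoint or its two path-neighbors $v_1,v_2$ satisfy $v_1u\perp uv_2$. A root-to-leaf path of $T$ is thus an alternating sequence $(u_0,s_1,u_1,\dots,s_j,u_j)$ of turning points and maximal straight line segments; the segment distance of $s_i$ (and of $u_i$) from $u_0$ is $i$. Fast line growth grows a straight segment of length $m$ from a single node in $O(\log m)$ time steps by repeatedly having every node of the segment generate a new node along the segment direction. -}

module Defs where

open import Data.Bool using (if_then_else_)
open import Data.Empty using (⊥)
open import Data.Integer as ℤ using (ℤ; +_; 0ℤ; 1ℤ; -1ℤ)
open import Data.List using (List; []; _∷_; _++_; length)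
open import Data.List.Membership.Propositional using (_∈_; _∉_)
open import Data.List.Relation.Unary.All as All using ()
open import Data.List.Relation.Unary.AllPairs as AllPairs using ()
open import Data.List.Relation.Unary.Any using (here)
open import Data.List.Relation.Unary.Unique.Propositional using (Unique)
open import Data.Nat as ℕ using (ℕ; zero; suc; pred; _≤_)
open import Data.Product using (_×_; _,_; ∃-syntax)
open import Data.Product.Properties using (≡-dec)
open import Data.Sum using (_⊎_)
open import Function.Bundles using (_⇔_)
open import Level using (0ℓ)
open import Relation.Binary.Construct.Closure.ReflexiveTransitive using (Star; ε)
open import Relation.Binary.Construct.Closure.Symmetric using (SymClosure)
open import Relation.Binary.Core using (Rel)
import Relation.Binary.Definitions as Bin
open import Relation.Binary.PropositionalEquality using (_≡_; _≢_; refl)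
open import Relation.Nullary using (¬_; Dec; no; does)
open import Relation.Nullary.Decidable using (_×-dec_; _⊎-dec_)
import Relation.Unary as Un

Point : Set
Point = ℤ × ℤ

origin : Point
origin = 0ℤ , 0ℤ

_≟_ : Bin.DecidableEquality Point
_≟_ = ≡-dec ℤ._≟_ ℤ._≟_

infixl 6 _⊕_ _⊖_
infixl 7 _•_

_⊕_ _⊖_ : Point → Point → Point
(x , y) ⊕ (x′ , y′) = x ℤ.+ x′ , y ℤ.+ y′
(x , y) ⊖ (x′ , y′) = x ℤ.- x′ , y ℤ.- y′

_•_ : ℕ → Point → Point
m • (x , y) = + m ℤ.* x , + m ℤ.* y

dot : Point → Point → ℤ
dot (x , y) (x′ , y′) = x ℤ.* x′ ℤ.+ y ℤ.* y′

manhattan : Point → Point → ℕ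
manhattan (x , y) (x′ , y′) = ℤ.∣ x ℤ.- x′ ∣ ℕ.+ ℤ.∣ y ℤ.- y′ ∣

data Dir : Set where
  north east south west : Dir

vec : Dir → Point
vec north = 0ℤ  , 1ℤ
vec east  = 1ℤ  , 0ℤ
vec south = 0ℤ  , -1ℤ
vec west  = -1ℤ , 0ℤ

-- Since nodes occupy distinct points, a node is identified with the
-- point it currently occupies.
record Shape : Set₁ where
  infix 4 _~_
  field
    nodes      : List Point
    distinct   : Unique nodes
    _~_        : Rel Point 0ℓ
    _~?_       : Bin.Decidable _~_
    ~-sym      : ∀ {p q} → p ~ q → q ~ p
    ~-node     : ∀ {p q} → p ~ q → p ∈ nodes
    ~-adjacent : ∀ {p q} → p ~ q → manhattan p q ≡ 1
    connected  : ∀ {p q} → p ∈ nodes → q ∈ nodes → Star _~_ p q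

  size : ℕ
  size = length nodes

open Shape using (nodes; size)

infix 4 _≋_

-- Equality of placed shapes.  No translation is quotiented out: a growth
-- process has a stationary anchor, which fixes the placement.
_≋_ : Shape → Shape → Set
S ≋ S′ = (∀ p → p ∈ nodes S ⇔ p ∈ nodes S′)
       × (∀ p q → Shape._~_ S p q ⇔ Shape._~_ S′ p q)

singleton : Point → Shape
singleton p = record
  { nodes      = p ∷ []
  ; distinct   = All.[] AllPairs.∷ AllPairs.[]
  ; _~_        = λ _ _ → ⊥
  ; _~?_       = λ _ _ → no (λ ())
  ; ~-sym      = λ ()
  ; ~-node     = λ ()
  ; ~-adjacent = λ ()
  ; connected  = λ { (here refl) (here refl) → ε }
  }

-- Path S a b ps: ps is a simple path from a to b.  The nodes are listed
-- backwards, so b is the head of ps and a is its last element.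
data Path (S : Shape) (a : Point) : Point → List Point → Set where
  start  : Path S a a (a ∷ [])
  extend : ∀ {b c ps} → Path S a b ps → Shape._~_ S b c → c ∉ ps →
           Path S a c (c ∷ ps)

-- Shapes are connected, so a tree shape is an acyclic one.
IsTree : Shape → Set
IsTree S = ∀ {a b ps} → Path S a b ps → 3 ≤ length ps → ¬ Shape._~_ S b a

Perpendicular : Point → Point → Point → Set
Perpendicular v₁ u v₂ = dot (u ⊖ v₁) (v₂ ⊖ u) ≡ 0ℤ

perpendicular? : ∀ v₁ u v₂ → Dec (Perpendicular v₁ u v₂)
perpendicular? v₁ u v₂ = dot (u ⊖ v₁) (v₂ ⊖ u) ℤ.≟ 0ℤ

innerTurns : List Point → ℕ
innerTurns (v₁ ∷ u ∷ v₂ ∷ ps) =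
  (if does (perpendicular? v₁ u v₂) then 1 else 0) ℕ.+ innerTurns (u ∷ v₂ ∷ ps)
innerTurns _ = 0

turningPoints : List Point → ℕ
turningPoints []           = 0
turningPoints (_ ∷ [])     = 1
turningPoints (p ∷ q ∷ ps) = 2 ℕ.+ innerTurns (p ∷ q ∷ ps)

-- A path (u₀, s₁, u₁, …, sⱼ, uⱼ) has j + 1 turning points and j segments.
segments : List Point → ℕ
segments ps = pred (turningPoints ps)

-- A leaf is a node without children; in particular the root of a
-- one-node tree is a leaf, and a root of degree one is not.
RootToLeaf : Shape → Point → Point → List Point → Set
RootToLeaf T u₀ v ps = Path T u₀ v ps × (∀ w → Shape._~_ T v w → w ∈ ps)

-- The points b + m d, …, b + 2 d, b + d.
line : Point → Dir → ℕ → List Point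
line b d zero    = []
line b d (suc m) = (b ⊕ suc m • vec d) ∷ line b d m

-- A maximal straight segment sᵢ of T with uᵢ₋₁ = b and uᵢ = b + m d.
-- When the paths to different leaves leave a straight line at different
-- nodes, their segments are initial parts of the one considered here.
record Segment (T : Shape) (u₀ : Point) (i : ℕ) (b : Point) (d : Dir) (m : ℕ) : Set where
  field
    nonempty     : 1 ≤ m
    before       : List Point
    path-to-base : Path T u₀ b before
    path-to-end  : Path T u₀ (b ⊕ m • vec d) (line b d m ++ before)
    base-dist    : suc (segments before) ≡ i
    end-dist     : segments (line b d m ++ before) ≡ i
    maximal      : ¬ Shape._~_ T (b ⊕ m • vec d) (b ⊕ suc m • vec d)

-- Nodes present after a step: old v is a previous node v, new u is the
-- node generated by u.
data Body : Set where
  old new : Point → Body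

-- The operations of one time step: every node u with Op u grows toward
-- u ⊕ vec dir.
record Operations (S : Shape) : Set₁ where
  field
    dir : Dir
    Op  : Un.Pred Point 0ℓ
    op? : Un.Decidable Op
    op∈ : ∀ {u} → Op u → u ∈ nodes S

  Toward : Rel Point 0ℓ
  Toward u v = Op u × v ≡ u ⊕ vec dir

  -- For an edge uv: it is replaced by two edges.
  Splits : Rel Point 0ℓ
  Splits u v = Toward u v ⊎ Toward v u

  splits? : Bin.Decidable Splits
  splits? u v = (op? u ×-dec (v ≟ (u ⊕ vec dir))) ⊎-dec (op? v ×-dec (u ≟ (v ⊕ vec dir)))

  -- The argument is a path from the anchor, so in c ∷ p ∷ ps the node p
  -- is the parent of c; splitting pc pushes c away from p, whichever of
  -- the two received the operation.
  displacement : List Point → Point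
  displacement (c ∷ p ∷ ps) =
    (if does (splits? p c) then c ⊖ p else origin) ⊕ displacement (p ∷ ps)
  displacement _ = origin

  Present : Un.Pred Body 0ℓ
  Present (old v) = v ∈ nodes S
  Present (new u) = Op u

  data Edge : Rel Body 0ℓ where
    kept    : ∀ {u v} → Shape._~_ S u v → ¬ Splits u v → Edge (old u) (old v)
    grown   : ∀ {u} → Op u → Edge (old u) (new u)
    spliced : ∀ {u v} → Shape._~_ S u v → Toward u v → Edge (new u) (old v)

  -- A generated node emerges from its generator during the step and ends
  -- next to it.
  initial : Body → Point
  initial (old v) = v
  initial (new u) = u

  -- move v is the point to which a previous node v is translated.
  final : (move : Point → Point) → Body → Point
  final move (old v) = move v
  final move (new u) = move u ⊕ vec dir

record Step (u₀ : Point) (S S′ : Shape) : Set₁ where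
  field
    tree   : IsTree S
    anchor : u₀ ∈ nodes S
    ops    : Operations S

  open Operations ops public

  field
    move     : Point → Point
    move-def : ∀ {v ps} → Path S u₀ v ps → move v ≡ v ⊕ displacement ps

    -- All motions are uniform.  At time a / (a + r) of the step a body x is
    -- at the point (r • initial x ⊕ a • final move x) / (a + r).  With a ≥ 1
    -- these are the rational times in (0,1]; trajectories with integral
    -- endpoints that meet at some real time also meet at a rational one.
    collision-free : ∀ {x y} → Present x → Present y → x ≢ y → ∀ a r → 1 ≤ a →
                     r • initial x ⊕ a • final move x ≢ r • initial y ⊕ a • final move y
    nodes′ : ∀ p → p ∈ nodes S′ ⇔ (∃[ x ] Present x × final move x ≡ p)
    edges′ : ∀ p q → Shape._~_ S′ p q ⇔
             (∃[ x ] ∃[ y ] SymClosure Edge x y × final move x ≡ p × final move y ≡ q)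

infixr 5 _∷_

data Growth (u₀ : Point) : Shape → Shape → ℕ → Set₁ where
  done : ∀ {S S′} → S ≋ S′ → Growth u₀ S S′ 0
  _∷_  : ∀ {S S′ S″ t} → Step u₀ S S′ → Growth u₀ S′ S″ t → Growth u₀ S S″ (suc t)

module _ (T : Shape) (u₀ : Point) where

  -- The points of T at segment distance at most i from u₀; a point inside
  -- a segment has the segment distance of that segment.
  Within : ℕ → Point → Set
  Within i p = ∃[ ps ] Path T u₀ p ps × segments ps ≤ i

  -- S is the part of T consisting of the segments at distance at most i.
  GrownUpTo : ℕ → Shape → Set
  GrownUpTo i S =
    (∀ p → p ∈ nodes S ⇔ Within i p) ×
    (∀ p q → Shape._~_ S p q ⇔ (Shape._~_ T p q × Within i p × Within i q))

  -- A step of phase i.  Only operations of a single direction are allowed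
  -- in a step, so it advances in parallel all segments at distance i having
  -- that direction.  Each node of such a segment grown so far, including
  -- the base, generates a node along the segment, unless fewer operations
  -- suffice to complete the segment.
  record FastLineStep (i : ℕ) {S S′ : Shape} (st : Step u₀ S S′) : Set where
    open Step st using (Op; dir)
    field
      only-segments : ∀ {u} → Op u →
        ∃[ b ] ∃[ m ] Segment T u₀ i b dir m × u ∈ (b ∷ line b dir m)
      all-segments : ∀ {b m} → Segment T u₀ i b dir m →
        (∀ {u} → u ∈ nodes S → u ∈ (b ∷ line b dir m) → Op u) ⊎
        (∀ {u} → u ∈ line b dir m → u ∈ nodes S′)

  -- Phase i g: g is the remainder, from some moment of phase i on, of a run
  -- of BFS on line segments.
  data Phase : ℕ → ∀ {S t} → Growth u₀ S T t → Set₁ where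
    finish : ∀ {i S} {e : S ≋ T} → Phase i (done {S = S} {S′ = T} e)
    grow   : ∀ {i S S′ t} {st : Step u₀ S S′} {g : Growth u₀ S′ T t} →
             FastLineStep i st → Phase i g → Phase i (st ∷ g)
    next   : ∀ {i S t} {g : Growth u₀ S T t} →
             GrownUpTo i S → Phase (suc i) g → Phase i g

  BFSOnLineSegments : ∀ {t} → Growth u₀ (singleton u₀) T t → Set₁
  BFSOnLineSegments g = Phase 1 g

{-# OPTIONS --safe #-}
module Submission where

-- Each intermediate shape is the subtree of T formed by the segments at
-- distance less than i from u₀ and by the first 2 ^ s nodes of each segment at
-- distance i, where s is the number of steps made so far in its direction.  On
-- a segment with m nodes present a step lets the first q ≤ m of them generate,
-- with q = m unless fewer complete the segment: the old node at offset x moves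
-- to x + min x q and the node generated at y < q ends at 2 y + 1.  No two nodes
-- collide, since a node that would be caught up by another one lies ahead of it
-- on the same segment and is displaced at least as far.  As no segment has more
-- than n < 2 ^ (1 + ⌊log₂ n⌋) nodes, a phase takes 4 (1 + ⌊log₂ n⌋) steps.

open import Defs
open import Data.Bool using (true; false; if_then_else_)
open import Data.Bool.Properties using (if-cong)
open import Data.Integer as ℤ using (ℤ; +_; -[1+_]; 0ℤ; 1ℤ)
import Data.Integer.Properties as ℤₚ
open import Data.Integer.Tactic.RingSolver using (solve-∀)
open import Algebra.Properties.AbelianGroup ℤₚ.+-0-abelianGroup using (∙-cancelʳ)
open import Data.List using (List; []; _∷_; _++_; length; filter; head)
open import Data.List.Membership.DecPropositional _≟_ using (_∈?_)
open import Data.List.Membership.Propositional using (_∈_; _∉_; find; lose)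
open import Data.List.Membership.Propositional.Properties
  using (∈-∃++; ∈-++⁻; ∈-++⁺ˡ; ∈-++⁺ʳ; ∈-filter⁺; ∈-filter⁻; ∈-length)
open import Data.List.Properties using (length-++-sucʳ; ∷-injectiveʳ; filter-accept; filter-reject)
open import Data.List.Relation.Binary.Subset.Propositional using (_⊆_)
open import Data.List.Relation.Unary.All as All using (All; []; _∷_)
open import Data.List.Relation.Unary.All.Properties using (¬Any⇒All¬; All¬⇒¬Any)
open import Data.List.Relation.Unary.AllPairs using ([]; _∷_)
open import Data.List.Relation.Unary.Any using (here; there; any?)
open import Data.List.Relation.Unary.Unique.Propositional using (Unique)
import Data.List.Relation.Unary.Unique.Propositional.Properties as Unique
open import Data.Maybe using (just)
open import Data.Maybe.Properties using (just-injective)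
open import Data.Nat as ℕ using (ℕ; zero; suc; _+_; _*_; _^_; _∸_; _⊓_; _≤_; _<_; z≤n; s≤s; NonZero; >-nonZero)
open import Data.Nat.Induction using (<-wellFounded)
open import Data.Nat.Logarithm using (⌊log₂_⌋; ⌊log₂⌋-mono-≤; ⌊log₂[2^n]⌋≡n)
open import Data.Nat.Properties hiding (_≟_)
import Data.Nat.Tactic.RingSolver as ℕ-Solver
open import Data.Product as Product using (∃-syntax; _×_; _,_; proj₁; proj₂)
open import Data.Sum as Sum using (_⊎_; inj₁; inj₂)
open import Data.Unit using (⊤; tt)
open import Function using (_∘_; id)
open import Function.Bundles using (_⇔_; mk⇔; Equivalence)
open import Induction.WellFounded using (Acc; acc)
open import Level using (0ℓ)
open import Relation.Binary.Construct.Closure.ReflexiveTransitive as Star using (Star; ε; _◅_; _◅◅_)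
open import Relation.Binary.Construct.Closure.Symmetric using (SymClosure; fwd; symmetric; fold; gfold)
open import Relation.Binary.Core using (Rel)
open import Relation.Binary.Definitions using (DecidableEquality; Symmetric)
open import Relation.Binary.PropositionalEquality
open import Relation.Nullary using (¬_; Dec; yes; no; does; contradiction)
open import Relation.Nullary.Decidable
  using (dec-true; dec-false; _×-dec_; _⊎-dec_; ¬?; map′; decidable-stable)
open import Relation.Unary using (Pred; Decidable; _≐_)
open Equivalence using (to; from)

if-elim : ∀ {a p} {A : Set a} (P : A → Set p) b {x y} → P x → P y → P (if b then x else y)
if-elim P true  Px Py = Px
if-elim P false Px Py = Py

module _ {p a} {P : Set p} {A : Set a} (P? : Dec P) {x y : A} where

  if-yes : P → (if does P? then x else y) ≡ x
  if-yes Px = if-cong (dec-true P? Px)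

  if-no : ¬ P → (if does P? then x else y) ≡ y
  if-no ¬Px = if-cong (dec-false P? ¬Px)

Unique-⊆⇒length≤ : ∀ {a} {A : Set a} {xs ys : List A} → Unique xs → xs ⊆ ys → length xs ≤ length ys
Unique-⊆⇒length≤ {xs = []}     _                  _     = z≤n
Unique-⊆⇒length≤ {xs = x ∷ xs} (x∉xs ∷ unique-xs) xs⊆ys with ∈-∃++ (xs⊆ys (here refl))
... | ys₁ , ys₂ , refl =
  ≤-trans (s≤s (Unique-⊆⇒length≤ unique-xs xs⊆rest)) (≤-reflexive (sym (length-++-sucʳ ys₁ x ys₂)))
  where
  xs⊆rest : xs ⊆ ys₁ ++ ys₂
  xs⊆rest z∈xs with ∈-++⁻ ys₁ (xs⊆ys (there z∈xs))
  ... | inj₁ z∈ys₁         = ∈-++⁺ˡ z∈ys₁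
  ... | inj₂ (here refl)   = contradiction refl (All.lookup x∉xs z∈xs)
  ... | inj₂ (there z∈ys₂) = ∈-++⁺ʳ ys₁ z∈ys₂

n<2^[1+⌊log₂n⌋] : ∀ n → n < 2 ^ suc ⌊log₂ n ⌋
n<2^[1+⌊log₂n⌋] n = ≰⇒> λ 2^≤n →
  1+n≰n (≤-trans (≤-reflexive (sym (⌊log₂[2^n]⌋≡n _))) (⌊log₂⌋-mono-≤ 2^≤n))

2≤n⇒1≤⌊log₂n⌋ : ∀ {n} → 2 ≤ n → 1 ≤ ⌊log₂ n ⌋
2≤n⇒1≤⌊log₂n⌋ 2≤n = ≤-trans (≤-reflexive (sym (⌊log₂[2^n]⌋≡n 1))) (⌊log₂⌋-mono-≤ 2≤n)

m+m<n+n⇒m<n : ∀ {m n} → m + m < n + n → m < n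
m+m<n+n⇒m<n m+m<n+n = ≰⇒> λ n≤m → <⇒≱ m+m<n+n (+-mono-≤ n≤m n≤m)

⊓-subadditive : ∀ m n o → m ⊓ (n + o) ≤ m ⊓ n + m ⊓ o
⊓-subadditive m n o with ⊓-sel m n
... | inj₁ m⊓n≡m rewrite m⊓n≡m = ≤-trans (m⊓n≤m m (n + o)) (m≤m+n m (m ⊓ o))
... | inj₂ m⊓n≡n rewrite m⊓n≡n | +-distribˡ-⊓ n m o = ⊓-monoˡ-≤ (n + o) (m≤n+m m n)

suc-⊓-< : ∀ {m n} → m < n → suc m ⊓ n ≡ suc (m ⊓ n)
suc-⊓-< m<n = trans (m≤n⇒m⊓n≡m m<n) (cong suc (sym (m≤n⇒m⊓n≡m (<⇒≤ m<n))))

suc-⊓-≥ : ∀ {m n} → n ≤ m → suc m ⊓ n ≡ m ⊓ n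
suc-⊓-≥ n≤m = trans (m≥n⇒m⊓n≡n (m≤n⇒m≤1+n n≤m)) (sym (m≥n⇒m⊓n≡n n≤m))

-- Doubling a segment

data Halved : ℕ → Set where
  even : ∀ n → Halved (n + n)
  odd  : ∀ n → Halved (suc (n + n))

halve : ∀ n → Halved n
halve zero = even 0
halve (suc n) with halve n
... | even m = odd m
... | odd m  = subst Halved (cong suc (+-suc m m)) (even (suc m))

-- Where the node at offset x of a segment goes when the nodes at offsets
-- below q each generate a node next to them.
stretch : ℕ → ℕ → ℕ
stretch q x = x + x ⊓ q

stretch-≤ : ∀ {q x} → x ≤ q → stretch q x ≡ x + x
stretch-≤ {q} {x} x≤q = cong (x ℕ.+_) (m≤n⇒m⊓n≡m x≤q)

stretch-≥ : ∀ {q x} → q ≤ x → stretch q x ≡ x + q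
stretch-≥ {q} {x} q≤x = cong (x ℕ.+_) (m≥n⇒m⊓n≡n q≤x)

stretch-suc-≤ : ∀ {q y} → suc y ≤ q → stretch q (suc y) ≡ suc (suc (y + y))
stretch-suc-≤ {q} {y} 1+y≤q = trans (stretch-≤ 1+y≤q) (cong suc (+-suc y y))

-- The origin of the edge from offset z to offset suc z of a stretched
-- segment whose first m nodes were present before.
data EdgeOrigin (m q : ℕ) : ℕ → Set where
  kept    : ∀ x → q ≤ x → suc x < m → EdgeOrigin m q (x + q)
  grown   : ∀ y → y < q → EdgeOrigin m q (y + y)
  spliced : ∀ y → y < q → suc y < m → EdgeOrigin m q (suc (y + y))

edgeOrigin : ∀ {m q z} → q ≤ m → suc z < m + q → EdgeOrigin m q z
edgeOrigin {m} {q} {z} q≤m 1+z<m+q with z <? q + q | halve z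
... | yes z<q+q | even y = grown y (m+m<n+n⇒m<n z<q+q)
... | yes z<q+q | odd y  = spliced y (m+m<n+n⇒m<n (<-trans (n<1+n _) z<q+q))
  (m+m<n+n⇒m<n (<-≤-trans (subst (λ n → suc n < m + q) (sym (+-suc y y)) 1+z<m+q) (+-monoʳ-≤ m q≤m)))
... | no  z≮q+q | _ =
  subst (EdgeOrigin m q) (m∸n+n≡m q≤z) (kept (z ∸ q) (m+n≤o⇒m≤o∸n q q+q≤z)
    (+-cancelʳ-< q _ _ (subst (λ n → suc n < m + q) (sym (m∸n+n≡m q≤z)) 1+z<m+q)))
  where
  q+q≤z : q + q ≤ z
  q+q≤z = ≮⇒≥ z≮q+q
  q≤z : q ≤ z
  q≤z = m+n≤o⇒m≤o q q+q≤z

-- The number of nodes, base included, that a segment of length n has after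
-- s steps, and the number of those that operate in the next step.
extent growth : ℕ → ℕ → ℕ
extent s n = suc n ⊓ 2 ^ s
growth s n = extent (suc s) n ∸ extent s n

2^[1+s]≡2^s+2^s : ∀ s → 2 ^ suc s ≡ 2 ^ s + 2 ^ s
2^[1+s]≡2^s+2^s s = cong (2 ^ s ℕ.+_) (+-identityʳ (2 ^ s))

<extent⇒≤ : ∀ s {n x} → x < extent s n → x ≤ n
<extent⇒≤ s {n} x<extent = m<1+n⇒m≤n (<-≤-trans x<extent (m⊓n≤m (suc n) (2 ^ s)))

extent+growth : ∀ s n → extent s n + growth s n ≡ extent (suc s) n
extent+growth s n = m+[n∸m]≡n (⊓-monoʳ-≤ (suc n) (m≤m+n (2 ^ s) _))

growth≤extent : ∀ s n → growth s n ≤ extent s n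
growth≤extent s n = m≤n+o⇒m∸n≤o (extent (suc s) n) (extent s n) (subst
  (λ k → suc n ⊓ k ≤ extent s n + extent s n) (sym (2^[1+s]≡2^s+2^s s)) (⊓-subadditive (suc n) (2 ^ s) (2 ^ s)))

<growth⇒<extent : ∀ s {n y} → y < growth s n → y < extent s n
<growth⇒<extent s {n} y<growth = <-≤-trans y<growth (growth≤extent s n)

<growth⇒1+y+y<extent : ∀ s {n y} → y < growth s n → suc (y + y) < extent (suc s) n
<growth⇒1+y+y<extent s {n} {y} y<growth = subst₂ _<_ (+-suc y y) (extent+growth s n)
  (+-mono-<-≤ (<growth⇒<extent s y<growth) y<growth)

<growth⇒< : ∀ s {n y} → y < growth s n → y < n
<growth⇒< s {n} {y} y<growth = ≤-trans (s≤s (m≤m+n y y)) (<extent⇒≤ (suc s) (<growth⇒1+y+y<extent s y<growth))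

stretch<extent : ∀ s {n x} → x < extent s n → stretch (growth s n) x < extent (suc s) n
stretch<extent s {n} {x} x<extent = subst (stretch (growth s n) x <_) (extent+growth s n)
  (+-mono-<-≤ x<extent (m⊓n≤n x (growth s n)))

full-or-complete : ∀ s n → growth s n ≡ extent s n ⊎ extent (suc s) n ≡ suc n
full-or-complete s n with ⊓-sel (suc n) (2 ^ suc s)
... | inj₁ complete = inj₂ complete
... | inj₂ full     = inj₁ (begin
  growth s n                        ≡⟨ cong (_∸ extent s n) full ⟩
  2 ^ suc s ∸ extent s n            ≡⟨ cong₂ _∸_ (2^[1+s]≡2^s+2^s s) extent≡2^s ⟩
  2 ^ s + 2 ^ s ∸ 2 ^ s             ≡⟨ m+n∸n≡m (2 ^ s) (2 ^ s) ⟩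
  2 ^ s                             ≡⟨ extent≡2^s ⟨
  extent s n                        ∎)
  where
  open ≡-Reasoning
  extent≡2^s : extent s n ≡ 2 ^ s
  extent≡2^s = m≥n⇒m⊓n≡n (≤-trans (m≤m+n (2 ^ s) _) (m⊓n≡n⇒n≤m full))

-- Points and directions

⊕-identityˡ : ∀ p → origin ⊕ p ≡ p
⊕-identityˡ (x , y) = cong₂ _,_ (ℤₚ.+-identityˡ x) (ℤₚ.+-identityˡ y)

⊕-identityʳ : ∀ p → p ⊕ origin ≡ p
⊕-identityʳ (x , y) = cong₂ _,_ (ℤₚ.+-identityʳ x) (ℤₚ.+-identityʳ y)

⊕-assoc : ∀ p q r → p ⊕ q ⊕ r ≡ p ⊕ (q ⊕ r)
⊕-assoc (x , y) (x′ , y′) (x″ , y″) = cong₂ _,_ (ℤₚ.+-assoc x x′ x″) (ℤₚ.+-assoc y y′ y″)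

[p⊕v]⊖p≡v : ∀ p v → (p ⊕ v) ⊖ p ≡ v
[p⊕v]⊖p≡v (x , y) (v , w) = cong₂ _,_ (ring x v) (ring y w)
  where
  ring : ∀ x v → x ℤ.+ v ℤ.- x ≡ v
  ring = solve-∀

q⊕[p⊖q]≡p : ∀ p q → q ⊕ (p ⊖ q) ≡ p
q⊕[p⊖q]≡p (x , y) (x′ , y′) = cong₂ _,_ (ring x x′) (ring y y′)
  where
  ring : ∀ x x′ → x′ ℤ.+ (x ℤ.- x′) ≡ x
  ring = solve-∀

⊕-cancelʳ : ∀ {p q} v → p ⊕ v ≡ q ⊕ v → p ≡ q
⊕-cancelʳ {x , y} {x′ , y′} (v , w) eq =
  cong₂ _,_ (∙-cancelʳ v x x′ (cong proj₁ eq)) (∙-cancelʳ w y y′ (cong proj₂ eq))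

•-suc : ∀ n v → suc n • v ≡ v ⊕ n • v
•-suc n (x , y) = cong₂ _,_ (ℤₚ.suc-* (+ n) x) (ℤₚ.suc-* (+ n) y)

scale : ℤ → Point → Point
scale t (x , y) = t ℤ.* x , t ℤ.* y

dot-scaleˡ : ∀ n v w → dot (scale n v) w ≡ n ℤ.* dot v w
dot-scaleˡ n (x , y) (x′ , y′) = ring n x y x′ y′
  where
  ring : ∀ n x y x′ y′ → n ℤ.* x ℤ.* x′ ℤ.+ n ℤ.* y ℤ.* y′ ≡ n ℤ.* (x ℤ.* x′ ℤ.+ y ℤ.* y′)
  ring = solve-∀

⊖-scale-neg : ∀ u v t w → v ⊖ u ≡ scale t w → u ⊖ v ≡ scale (ℤ.- t) w
⊖-scale-neg (x , y) (x′ , y′) t (s , s′) eq =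
  cong₂ _,_ (negate x x′ s (cong proj₁ eq)) (negate y y′ s′ (cong proj₂ eq))
  where
  ring : ∀ x x′ → x ℤ.- x′ ≡ ℤ.- (x′ ℤ.- x)
  ring = solve-∀
  negate : ∀ x x′ s → x′ ℤ.- x ≡ t ℤ.* s → x ℤ.- x′ ≡ ℤ.- t ℤ.* s
  negate x x′ s x′-x≡ts = trans (ring x x′) (trans (cong ℤ.-_ x′-x≡ts) (ℤₚ.neg-distribˡ-* t s))

manhattan-self : ∀ p → manhattan p p ≡ 0
manhattan-self (x , y) = cong₂ (λ a b → ℤ.∣ a ∣ + ℤ.∣ b ∣) (ℤₚ.+-inverseʳ x) (ℤₚ.+-inverseʳ y)

dot-vec-self : ∀ d → dot (vec d) (vec d) ≡ 1ℤ
dot-vec-self north = refl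
dot-vec-self east  = refl
dot-vec-self south = refl
dot-vec-self west  = refl

unit⇒vec : ∀ x y → ℤ.∣ x ∣ + ℤ.∣ y ∣ ≡ 1 → ∃[ d ] (x , y) ≡ vec d
unit⇒vec (+ 0)      (+ 1)      refl = north , refl
unit⇒vec (+ 0)      (-[1+ 0 ]) refl = south , refl
unit⇒vec (+ 1)      (+ 0)      refl = east  , refl
unit⇒vec (-[1+ 0 ]) (+ 0)      refl = west  , refl

toDir : Point → Dir
toDir (+ suc _  , _)        = east
toDir (-[1+ _ ] , _)        = west
toDir (+ 0      , -[1+ _ ]) = south
toDir (+ 0      , + _)      = north

toDir-vec : ∀ d → toDir (vec d) ≡ d
toDir-vec north = refl
toDir-vec east  = refl
toDir-vec south = refl
toDir-vec west  = refl

vec-injective : ∀ {d e} → vec d ≡ vec e → d ≡ e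
vec-injective {d} {e} eq = trans (sym (toDir-vec d)) (trans (cong toDir eq) (toDir-vec e))

_≟ᵈ_ : DecidableEquality Dir
d ≟ᵈ e = map′ vec-injective (cong vec) (vec d ≟ vec e)

Opposite : Dir → Dir → Set
Opposite d e = vec d ⊕ vec e ≡ origin

data Directions (d e : Dir) : Set where
  same          : d ≡ e → Directions d e
  opposite      : Opposite d e → Directions d e
  perpendicular : dot (vec d) (vec e) ≡ 0ℤ → Directions d e

compareDir : ∀ d e → Directions d e
compareDir north north = same refl
compareDir north east  = perpendicular refl
compareDir north south = opposite refl
compareDir north west  = perpendicular refl
compareDir east  north = perpendicular refl
compareDir east  east  = same refl
compareDir east  south = perpendicular refl
compareDir east  west  = opposite refl
compareDir south north = opposite refl
compareDir south east  = perpendicular refl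
compareDir south south = same refl
compareDir south west  = perpendicular refl
compareDir west  north = perpendicular refl
compareDir west  east  = opposite refl
compareDir west  south = perpendicular refl
compareDir west  west  = same refl

at : Point → Dir → ℕ → Point
at b d x = b ⊕ x • vec d

at-zero : ∀ b d → at b d 0 ≡ b
at-zero b _ = ⊕-identityʳ b

at-suc : ∀ b d x → at b d (suc x) ≡ at b d x ⊕ vec d
at-suc (b₁ , b₂) d x = cong₂ _,_ (ring b₁ (+ x) (proj₁ (vec d))) (ring b₂ (+ x) (proj₂ (vec d)))
  where
  ring : ∀ b x v → b ℤ.+ (1ℤ ℤ.+ x) ℤ.* v ≡ b ℤ.+ x ℤ.* v ℤ.+ v
  ring = solve-∀

at-+ : ∀ b d x y → at (at b d x) d y ≡ at b d (x + y)
at-+ (b₁ , b₂) d x y =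
  cong₂ _,_ (ring b₁ (proj₁ (vec d)) (+ x) (+ y)) (ring b₂ (proj₂ (vec d)) (+ x) (+ y))
  where
  ring : ∀ b v x y → b ℤ.+ x ℤ.* v ℤ.+ y ℤ.* v ≡ b ℤ.+ (x ℤ.+ y) ℤ.* v
  ring = solve-∀

at-injective : ∀ b d {x y} → at b d x ≡ at b d y → x ≡ y
at-injective b d {x} {y} eq = ℤₚ.+-injective (begin
  + x                              ≡⟨ offset x ⟨
  dot (at b d x ⊖ b) (vec d)       ≡⟨ cong (λ p → dot (p ⊖ b) (vec d)) eq ⟩
  dot (at b d y ⊖ b) (vec d)       ≡⟨ offset y ⟩
  + y                              ∎)
  where
  open ≡-Reasoning
  offset : ∀ x → dot (at b d x ⊖ b) (vec d) ≡ + x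
  offset x = begin
    dot (at b d x ⊖ b) (vec d)     ≡⟨ cong (λ p → dot p (vec d)) ([p⊕v]⊖p≡v b (x • vec d)) ⟩
    dot (x • vec d) (vec d)        ≡⟨ dot-scaleˡ (+ x) (vec d) (vec d) ⟩
    + x ℤ.* dot (vec d) (vec d)    ≡⟨ cong (+ x ℤ.*_) (dot-vec-self d) ⟩
    + x ℤ.* 1ℤ                     ≡⟨ ℤₚ.*-identityʳ (+ x) ⟩
    + x                            ∎

at-one : ∀ b d → at b d 1 ≡ b ⊕ vec d
at-one b d = trans (at-suc b d 0) (cong (_⊕ vec d) (at-zero b d))

at-step : ∀ b d x → at (at b d x) d 1 ≡ at b d (suc x)
at-step b d x = trans (at-+ b d x 1) (cong (at b d) (+-comm x 1))

at-back : ∀ b d e x → Opposite d e → at (at b d (suc x)) e 1 ≡ at b d x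
at-back b d e x d⊕e≡0 = begin
  at (at b d (suc x)) e 1      ≡⟨ at-one (at b d (suc x)) e ⟩
  at b d (suc x) ⊕ vec e       ≡⟨ cong (_⊕ vec e) (at-suc b d x) ⟩
  at b d x ⊕ vec d ⊕ vec e     ≡⟨ ⊕-assoc (at b d x) (vec d) (vec e) ⟩
  at b d x ⊕ (vec d ⊕ vec e)   ≡⟨ cong (at b d x ⊕_) d⊕e≡0 ⟩
  at b d x ⊕ origin            ≡⟨ ⊕-identityʳ (at b d x) ⟩
  at b d x                     ∎
  where open ≡-Reasoning

adjacent⇒at : ∀ p q → manhattan p q ≡ 1 → ∃[ d ] p ≡ at q d 1
adjacent⇒at p q p~q =
  let d , p⊖q≡vec = unit⇒vec (proj₁ (p ⊖ q)) (proj₂ (p ⊖ q)) p~q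
  in d , (begin
    p              ≡⟨ q⊕[p⊖q]≡p p q ⟨
    q ⊕ (p ⊖ q)    ≡⟨ cong (q ⊕_) p⊖q≡vec ⟩
    q ⊕ vec d      ≡⟨ at-one q d ⟨
    at q d 1       ∎)
  where open ≡-Reasoning

dot-steps : ∀ b d e x →
  dot (at b d (suc x) ⊖ at (at b d (suc x)) e 1) (at b d x ⊖ at b d (suc x)) ≡ dot (vec d) (vec e)
dot-steps b d e x = subst
  (λ p → dot (p ⊖ at p e 1) (at b d x ⊖ p) ≡ dot (vec d) (vec e)) (at-step b d x) (first-steps (at b d x))
  where
  first-steps : ∀ q → dot (at q d 1 ⊖ at (at q d 1) e 1) (q ⊖ at q d 1) ≡ dot (vec d) (vec e)
  first-steps (x , y) = ring x y _ _ _ _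
    where
    ring : ∀ x y d₁ d₂ e₁ e₂ →
      (x ℤ.+ 1ℤ ℤ.* d₁ ℤ.- (x ℤ.+ 1ℤ ℤ.* d₁ ℤ.+ 1ℤ ℤ.* e₁)) ℤ.* (x ℤ.- (x ℤ.+ 1ℤ ℤ.* d₁)) ℤ.+
      (y ℤ.+ 1ℤ ℤ.* d₂ ℤ.- (y ℤ.+ 1ℤ ℤ.* d₂ ℤ.+ 1ℤ ℤ.* e₂)) ℤ.* (y ℤ.- (y ℤ.+ 1ℤ ℤ.* d₂)) ≡
      d₁ ℤ.* e₁ ℤ.+ d₂ ℤ.* e₂
    ring = solve-∀

¬perpendicular-ahead : ∀ b d x → ¬ Perpendicular (at b d (2 + x)) (at b d (1 + x)) (at b d x)
¬perpendicular-ahead b d x perp = contradiction (begin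
  0ℤ
    ≡⟨ perp ⟨
  dot (at b d (1 + x) ⊖ at b d (2 + x)) (at b d x ⊖ at b d (1 + x))
    ≡⟨ cong (λ c → dot (at b d (1 + x) ⊖ c) (at b d x ⊖ at b d (1 + x))) (at-step b d (1 + x)) ⟨
  dot (at b d (1 + x) ⊖ at (at b d (1 + x)) d 1) (at b d x ⊖ at b d (1 + x))
    ≡⟨ dot-steps b d d x ⟩
  dot (vec d) (vec d)
    ≡⟨ dot-vec-self d ⟩
  1ℤ ∎) λ ()
  where open ≡-Reasoning

-- As vec d is a unit vector, the factor is a scalar product with it.
scale-vec : ∀ n .{{_ : ℤ.NonZero n}} g d w → scale n w ≡ scale g (vec d) →
            ∃[ t ] n ℤ.* t ≡ g × w ≡ scale t (vec d)
scale-vec n g d w@(x , y) eq =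
  t , nt≡g , cong₂ _,_ (cancel-n x (proj₁ (vec d)) (cong proj₁ eq)) (cancel-n y (proj₂ (vec d)) (cong proj₂ eq))
  where
  open ≡-Reasoning
  t : ℤ
  t = dot w (vec d)
  nt≡g : n ℤ.* t ≡ g
  nt≡g = begin
    n ℤ.* dot w (vec d)                         ≡⟨ dot-scaleˡ n w (vec d) ⟨
    dot (scale n w) (vec d)                     ≡⟨ cong (λ p → dot p (vec d)) eq ⟩
    dot (scale g (vec d)) (vec d)               ≡⟨ dot-scaleˡ g (vec d) (vec d) ⟩
    g ℤ.* dot (vec d) (vec d)                   ≡⟨ cong (g ℤ.*_) (dot-vec-self d) ⟩
    g ℤ.* 1ℤ                                    ≡⟨ ℤₚ.*-identityʳ g ⟩
    g                                           ∎
  cancel-n : ∀ z s → n ℤ.* z ≡ g ℤ.* s → z ≡ t ℤ.* s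
  cancel-n z s nz≡gs = ℤₚ.*-cancelˡ-≡ n z (t ℤ.* s) (begin
    n ℤ.* z             ≡⟨ nz≡gs ⟩
    g ℤ.* s             ≡⟨ cong (ℤ._* s) nt≡g ⟨
    n ℤ.* t ℤ.* s       ≡⟨ ℤₚ.*-assoc n t s ⟩
    n ℤ.* (t ℤ.* s)     ∎)

-- How two bodies moving k and l units in direction d from u and v can meet.
data Meeting (d : Dir) (u : Point) (k : ℕ) (v : Point) (l : ℕ) : Set where
  together : u ≡ v → k ≡ l → Meeting d u k v l
  catching : ∀ t → v ≡ at u d (suc t) → suc t + l ≤ k → Meeting d u k v l
  caught   : ∀ t → u ≡ at v d (suc t) → suc t + k ≤ l → Meeting d u k v l

module _ (a r : ℕ) (1≤a : 1 ≤ a) where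

  private
    instance
      a≢0 : NonZero a
      a≢0 = >-nonZero 1≤a
      r+a≢0 : NonZero (r + a)
      r+a≢0 = >-nonZero (≤-trans 1≤a (m≤n+m a r))

  gain : ℕ → ℕ → ℤ
  gain k l = + a ℤ.* (+ k ℤ.- + l)

  gain-swap : ∀ k l → ℤ.- gain k l ≡ gain l k
  gain-swap k l = ring (+ a) (+ k) (+ l)
    where
    ring : ∀ a k l → ℤ.- (a ℤ.* (k ℤ.- l)) ≡ a ℤ.* (l ℤ.- k)
    ring = solve-∀

  relativeMotion : ∀ d {u v} k l → r • u ⊕ a • at u d k ≡ r • v ⊕ a • at v d l →
    scale (+ (r + a)) (v ⊖ u) ≡ scale (gain k l) (vec d)
  relativeMotion d {x , y} {x′ , y′} k l eq =
    cong₂ _,_ (coordinate x x′ (proj₁ (vec d)) (cong proj₁ eq)) (coordinate y y′ (proj₂ (vec d)) (cong proj₂ eq))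
    where
    open ≡-Reasoning
    coordinate : ∀ x x′ s →
      + r ℤ.* x ℤ.+ + a ℤ.* (x ℤ.+ + k ℤ.* s) ≡ + r ℤ.* x′ ℤ.+ + a ℤ.* (x′ ℤ.+ + l ℤ.* s) →
      + (r + a) ℤ.* (x′ ℤ.- x) ≡ gain k l ℤ.* s
    coordinate x x′ s X≡X′ = begin
      + (r + a) ℤ.* (x′ ℤ.- x)       ≡⟨ ring (+ r) (+ a) x x′ s (+ k) (+ l) ⟩
      X′ ℤ.- X ℤ.+ gain k l ℤ.* s    ≡⟨ cong (ℤ._+ gain k l ℤ.* s) (ℤₚ.i≡j⇒i-j≡0 (sym X≡X′)) ⟩
      0ℤ ℤ.+ gain k l ℤ.* s          ≡⟨ ℤₚ.+-identityˡ (gain k l ℤ.* s) ⟩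
      gain k l ℤ.* s                 ∎
      where
      X X′ : ℤ
      X  = + r ℤ.* x ℤ.+ + a ℤ.* (x ℤ.+ + k ℤ.* s)
      X′ = + r ℤ.* x′ ℤ.+ + a ℤ.* (x′ ℤ.+ + l ℤ.* s)
      ring : ∀ r a x x′ s k l →
        (r ℤ.+ a) ℤ.* (x′ ℤ.- x) ≡
        r ℤ.* x′ ℤ.+ a ℤ.* (x′ ℤ.+ l ℤ.* s) ℤ.- (r ℤ.* x ℤ.+ a ℤ.* (x ℤ.+ k ℤ.* s)) ℤ.+ a ℤ.* (k ℤ.- l) ℤ.* s
      ring = solve-∀

  headway : ∀ t k l → + (r + a) ℤ.* + t ≡ gain k l → r * t + a * (t + l) ≡ a * k
  headway t k l eq = ℤₚ.+-injective (begin
    + (r * t + a * (t + l))                          ≡⟨ cong₂ ℤ._+_ (ℤₚ.pos-* r t) (ℤₚ.pos-* a (t + l)) ⟩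
    + r ℤ.* + t ℤ.+ + a ℤ.* (+ t ℤ.+ + l)            ≡⟨ ring (+ r) (+ a) (+ t) (+ l) ⟩
    + (r + a) ℤ.* + t ℤ.+ + a ℤ.* + l                ≡⟨ cong (ℤ._+ + a ℤ.* + l) eq ⟩
    gain k l ℤ.+ + a ℤ.* + l                         ≡⟨ ring′ (+ a) (+ k) (+ l) ⟩
    + a ℤ.* + k                                      ≡⟨ ℤₚ.pos-* a k ⟨
    + (a * k)                                        ∎)
    where
    open ≡-Reasoning
    ring : ∀ r a t l → r ℤ.* t ℤ.+ a ℤ.* (t ℤ.+ l) ≡ (r ℤ.+ a) ℤ.* t ℤ.+ a ℤ.* l
    ring = solve-∀
    ring′ : ∀ a k l → a ℤ.* (k ℤ.- l) ℤ.+ a ℤ.* l ≡ a ℤ.* k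
    ring′ = solve-∀

  headway-≡ : ∀ k l → + (r + a) ℤ.* 0ℤ ≡ gain k l → k ≡ l
  headway-≡ k l eq =
    sym (*-cancelˡ-≡ l k a (trans (cong (_+ a * l) (sym (*-zeroʳ r))) (headway 0 k l eq)))

  headway-≤ : ∀ t k l → + (r + a) ℤ.* + t ≡ gain k l → t + l ≤ k
  headway-≤ t k l eq = *-cancelˡ-≤ a (≤-trans (m≤n+m _ (r * t)) (≤-reflexive (headway t k l eq)))

  meeting : ∀ d {u v k l} → r • u ⊕ a • at u d k ≡ r • v ⊕ a • at v d l → Meeting d u k v l
  meeting d {u} {v} {k} {l} eq =
    by-sign (scale-vec (+ (r + a)) (gain k l) d (v ⊖ u) (relativeMotion d k l eq))
    where
    ahead : ∀ {p q} t → q ⊖ p ≡ t • vec d → q ≡ at p d t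
    ahead {p} {q} t q⊖p≡ = trans (sym (q⊕[p⊖q]≡p q p)) (cong (p ⊕_) q⊖p≡)
    by-sign : ∃[ t ] + (r + a) ℤ.* t ≡ gain k l × v ⊖ u ≡ scale t (vec d) → Meeting d u k v l
    by-sign (+ 0      , nt≡ , v⊖u≡) = together (sym (trans (ahead 0 v⊖u≡) (at-zero u d))) (headway-≡ k l nt≡)
    by-sign (+ suc t  , nt≡ , v⊖u≡) = catching t (ahead (suc t) v⊖u≡) (headway-≤ (suc t) k l nt≡)
    by-sign (-[1+ t ] , nt≡ , v⊖u≡) = caught t
      (ahead (suc t) (⊖-scale-neg u v -[1+ t ] (vec d) v⊖u≡))
      (headway-≤ (suc t) l k (begin
        + (r + a) ℤ.* + suc t            ≡⟨ ℤₚ.neg-distribʳ-* (+ (r + a)) -[1+ t ] ⟨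
        ℤ.- (+ (r + a) ℤ.* -[1+ t ])     ≡⟨ cong ℤ.-_ nt≡ ⟩
        ℤ.- gain k l                     ≡⟨ gain-swap k l ⟩
        gain l k                         ∎))
      where open ≡-Reasoning

-- Paths and their segments

head⇒∈ : ∀ {a} {A : Set a} {x : A} {xs} → head xs ≡ just x → x ∈ xs
head⇒∈ {xs = _ ∷ _} refl = here refl

Restricted : Shape → Pred Point 0ℓ → Rel Point 0ℓ
Restricted S P p q = Shape._~_ S p q × P p × P q

module _ {S : Shape} where

  open Shape S using (nodes; size; _~_; ~-sym; ~-node; ~-adjacent)

  ~-irrefl : ∀ {p q} → p ~ q → p ≢ q
  ~-irrefl {p} p~p refl = contradiction (trans (sym (~-adjacent p~p)) (manhattan-self p)) λ ()

  ~-nodeʳ : ∀ {p q} → p ~ q → q ∈ nodes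
  ~-nodeʳ = ~-node ∘ ~-sym

  restricted-sym : ∀ {P} → Symmetric (Restricted S P)
  restricted-sym (p~q , Pp , Pq) = ~-sym p~q , Pq , Pp

  path-head : ∀ {a b ps} → Path S a b ps → head ps ≡ just b
  path-head start          = refl
  path-head (extend _ _ _) = refl

  path-end-unique : ∀ {a a′ b c ps} → Path S a b ps → Path S a′ c ps → b ≡ c
  path-end-unique p q = just-injective (trans (sym (path-head p)) (path-head q))

  path-end∈ : ∀ {a b ps} → Path S a b ps → b ∈ ps
  path-end∈ p = head⇒∈ (path-head p)

  path-start∈ : ∀ {a b ps} → Path S a b ps → a ∈ ps
  path-start∈ start          = here refl
  path-start∈ (extend p _ _) = there (path-start∈ p)

  path⊆nodes : ∀ {a b ps} → a ∈ nodes → Path S a b ps → ps ⊆ nodes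
  path⊆nodes a∈ start            (here refl) = a∈
  path⊆nodes a∈ (extend p b~c _) (here refl) = ~-nodeʳ b~c
  path⊆nodes a∈ (extend p _   _) (there q∈)  = path⊆nodes a∈ p q∈

  path-unique-nodes : ∀ {a b ps} → Path S a b ps → Unique ps
  path-unique-nodes start             = [] ∷ []
  path-unique-nodes (extend p _ c∉ps) = ¬Any⇒All¬ _ c∉ps ∷ path-unique-nodes p

  path-length≤size : ∀ {a b ps} → a ∈ nodes → Path S a b ps → length ps ≤ size
  path-length≤size a∈ p = Unique-⊆⇒length≤ (path-unique-nodes p) (path⊆nodes a∈ p)

  path-tail : ∀ {a b c p ps} → Path S a c (b ∷ ps) → head ps ≡ just p →
              Path S a p ps × p ~ c × c ∉ ps
  path-tail (extend p b~c c∉ps) ps-head with refl ← trans (sym (path-head p)) ps-head = p , b~c , c∉ps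

  truncate : ∀ {a b c ps} → Path S a b ps → c ∈ ps → ∃[ qs ] Path S a c qs × qs ⊆ ps
  truncate start            (here refl) = _ , start , id
  truncate p@(extend _ _ _) (here refl) = _ , p , id
  truncate (extend p _ _)   (there c∈) =
    let qs , q , qs⊆ps = truncate p c∈ in qs , q , there ∘ qs⊆ps

  loopErase : ∀ {P a b c ps} → Path S a b ps → All P ps → Star (Restricted S P) b c →
              ∃[ qs ] Path S a c qs × All P qs
  loopErase p all-P ε = _ , p , all-P
  loopErase {ps = ps} p all-P (_◅_ {j = q} (b~q , _ , Pq) walk) with q ∈? ps
  ... | no  q∉ps = loopErase (extend p b~q q∉ps) (Pq ∷ all-P) walk
  ... | yes q∈ps = let _ , p′ , qs⊆ps = truncate p q∈ps in
    loopErase p′ (All.tabulate (All.lookup all-P ∘ qs⊆ps)) walk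

  path⇒walk : ∀ {P a b ps} → Path S a b ps → All P ps → Star (Restricted S P) a b
  path⇒walk start            _            = ε
  path⇒walk (extend p b~c _) (Pc ∷ all-P) =
    path⇒walk p all-P ◅◅ ((b~c , All.lookup all-P (path-end∈ p) , Pc) ◅ ε)

  -- Extension is well-founded, since a path has at most size nodes.
  path-rec : ∀ {a} → a ∈ nodes → (Q : Point → List Point → Set) →
    (∀ {v ps} → Path S a v ps → (∀ {w} → Path S a w (w ∷ ps) → Q w (w ∷ ps)) → Q v ps) →
    ∀ {v ps} → Path S a v ps → Q v ps
  path-rec {a} a∈ Q from-extensions p = rec p (<-wellFounded _)
    where
    rec : ∀ {v ps} → Path S a v ps → Acc _<_ (size ∸ length ps) → Q v ps
    rec p (acc smaller) = from-extensions p λ p′ →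
      rec p′ (smaller (∸-monoʳ-< (n<1+n _) (path-length≤size a∈ p′)))

segments-∷ : ∀ c ps → segments ps ≤ segments (c ∷ ps)
segments-∷ c []           = z≤n
segments-∷ c (p ∷ [])     = z≤n
segments-∷ c (p ∷ q ∷ ps) = s≤s (m≤n+m _ _)

segments-straight : ∀ {c p q} ps → ¬ Perpendicular c p q →
                    segments (c ∷ p ∷ q ∷ ps) ≡ segments (p ∷ q ∷ ps)
segments-straight {c} {p} {q} ps ¬perp =
  cong (λ turns → suc (turns + innerTurns (p ∷ q ∷ ps))) (if-no (perpendicular? c p q) ¬perp)

segments-turn : ∀ {c p q} ps → Perpendicular c p q →
                segments (c ∷ p ∷ q ∷ ps) ≡ suc (segments (p ∷ q ∷ ps))
segments-turn {c} {p} {q} ps perp =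
  cong (λ turns → suc (turns + innerTurns (p ∷ q ∷ ps))) (if-yes (perpendicular? c p q) perp)

lastLength : List Point → ℕ
lastLength (c ∷ p ∷ ps) =
  if does (segments (c ∷ p ∷ ps) ℕ.≟ segments (p ∷ ps)) then suc (lastLength (p ∷ ps)) else 1
lastLength _ = 0

-- The value is junk on a path without edges.
lastDir : List Point → Dir
lastDir (c ∷ p ∷ ps) = toDir (c ⊖ p)
lastDir _            = north

∈-base∷line⁺ : ∀ b d {m x} → x ≤ m → at b d x ∈ b ∷ line b d m
∈-base∷line⁺ b d {x = zero}  _     = here (at-zero b d)
∈-base∷line⁺ b d {x = suc x} x<m   = there (∈-line⁺ x<m)
  where
  ∈-line⁺ : ∀ {m x} → x < m → at b d (suc x) ∈ line b d m
  ∈-line⁺ {suc m} {x} (s≤s x≤m) with m≤n⇒m<n∨m≡n x≤m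
  ... | inj₁ x<m  = there (∈-line⁺ x<m)
  ... | inj₂ refl = here refl

∈-base∷line⁻ : ∀ b d m {u} → u ∈ b ∷ line b d m → ∃[ x ] x ≤ m × u ≡ at b d x
∈-base∷line⁻ b d m       (here refl)         = 0 , z≤n , sym (at-zero b d)
∈-base∷line⁻ b d (suc m) (there (here refl)) = suc m , ≤-refl , refl
∈-base∷line⁻ b d (suc m) (there (there u∈))  =
  let x , x≤m , u≡ = ∈-base∷line⁻ b d m (there u∈) in x , m≤n⇒m≤1+n x≤m , u≡

line-++-cancel : ∀ b b′ d x {ps qs} → line b d x ++ ps ≡ line b′ d x ++ qs → ps ≡ qs
line-++-cancel b b′ d zero    eq = eq
line-++-cancel b b′ d (suc x) eq = line-++-cancel b b′ d x (∷-injectiveʳ eq)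

-- From a path with a single node every step counts as a turn.
Turn : Point → Dir → List Point → Set
Turn b d ps = segments (at b d 1 ∷ ps) ≡ suc (segments ps)

lastLength-turn : ∀ {b d ps} → head ps ≡ just b → Turn b d ps → lastLength (at b d 1 ∷ ps) ≡ 1
lastLength-turn {b} {d} {_ ∷ qs} refl turn = if-no (segments (at b d 1 ∷ b ∷ qs) ℕ.≟ segments (b ∷ qs))
  λ straight → 1+n≢n (trans (sym turn) straight)

module _ {b : Point} {ps : List Point} (ps-head : head ps ≡ just b) (d : Dir) where

  head-line : ∀ x → head (line b d x ++ ps) ≡ just (at b d x)
  head-line zero    = trans ps-head (cong just (sym (at-zero b d)))
  head-line (suc x) = refl

  segments-line-suc : ∀ x → segments (line b d (2 + x) ++ ps) ≡ segments (line b d (1 + x) ++ ps)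
  segments-line-suc x with line b d x ++ ps | head-line x
  ... | _ ∷ rs | refl = segments-straight rs (¬perpendicular-ahead b d x)

  segments-line : ∀ x → 1 ≤ x → segments (line b d x ++ ps) ≡ segments (at b d 1 ∷ ps)
  segments-line 1             _ = refl
  segments-line (suc (suc x)) _ = trans (segments-line-suc x) (segments-line (suc x) (s≤s z≤n))

  lastDir-line : ∀ x → lastDir (line b d (suc x) ++ ps) ≡ d
  lastDir-line x with line b d x ++ ps | head-line x
  ... | _ ∷ _ | refl = begin
    toDir (at b d (suc x) ⊖ at b d x)       ≡⟨ cong (λ p → toDir (p ⊖ at b d x)) (at-suc b d x) ⟩
    toDir (at b d x ⊕ vec d ⊖ at b d x)     ≡⟨ cong toDir ([p⊕v]⊖p≡v (at b d x) (vec d)) ⟩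
    toDir (vec d)                           ≡⟨ toDir-vec d ⟩
    d                                       ∎
    where open ≡-Reasoning

  lastLength-line : Turn b d ps → ∀ x → lastLength (line b d (suc x) ++ ps) ≡ suc x
  lastLength-line turn zero    = lastLength-turn {d = d} ps-head turn
  lastLength-line turn (suc x) = trans
    (if-yes (segments (line b d (2 + x) ++ ps) ℕ.≟ segments (line b d (1 + x) ++ ps)) (segments-line-suc x))
    (cong suc (lastLength-line turn x))

lastLength≤length : ∀ ps → lastLength ps ≤ length ps
lastLength≤length []           = z≤n
lastLength≤length (_ ∷ [])     = z≤n
lastLength≤length (c ∷ p ∷ ps) = if-elim (_≤ length (c ∷ p ∷ ps))
  (does (segments (c ∷ p ∷ ps) ℕ.≟ segments (p ∷ ps))) (s≤s (lastLength≤length (p ∷ ps))) (s≤s z≤n)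

segments>0⇒lastLength>0 : ∀ ps → 0 < segments ps → 0 < lastLength ps
segments>0⇒lastLength>0 (c ∷ p ∷ ps) _ = if-elim (0 <_)
  (does (segments (c ∷ p ∷ ps) ℕ.≟ segments (p ∷ ps))) (s≤s z≤n) (s≤s z≤n)

segments<length : ∀ p ps → segments (p ∷ ps) < length (p ∷ ps)
segments<length p []       = s≤s z≤n
segments<length c (p ∷ ps) = s≤s (s≤s (innerTurns≤length c p ps))
  where
  innerTurns≤length : ∀ c p ps → innerTurns (c ∷ p ∷ ps) ≤ length ps
  innerTurns≤length c p []       = z≤n
  innerTurns≤length c p (q ∷ ps) with perpendicular? c p q
  ... | yes _ = s≤s (innerTurns≤length p q ps)
  ... | no  _ = m≤n⇒m≤1+n (innerTurns≤length p q ps)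

module _ {S : Shape} {a : Point} where

  open Shape S using (_~_; ~-sym; ~-adjacent)

  straight-tail : ∀ {b d ps x} → head ps ≡ just b → Path S a (at b d (suc x)) (line b d (suc x) ++ ps) →
                  Path S a (at b d x) (line b d x ++ ps) × at b d x ~ at b d (suc x)
  straight-tail {d = d} {x = x} ps-head path =
    let path′ , edge , _ = path-tail path (head-line ps-head d x) in path′ , edge

  straight-prefix : ∀ {b d ps x y} → head ps ≡ just b → y ≤ x →
                    Path S a (at b d x) (line b d x ++ ps) → Path S a (at b d y) (line b d y ++ ps)
  straight-prefix {x = zero}  ps-head z≤n   path = path
  straight-prefix {x = suc x} ps-head y≤1+x path with m≤n⇒m<n∨m≡n y≤1+x
  ... | inj₁ (s≤s y≤x) = straight-prefix ps-head y≤x (proj₁ (straight-tail ps-head path))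
  ... | inj₂ refl      = path

  data LastRun : Point → List Point → Set where
    none     : LastRun a (a ∷ [])
    straight : ∀ {b ps} d x → Path S a b ps → Turn b d ps →
               LastRun (at b d (suc x)) (line b d (suc x) ++ ps)

  lastRun : ∀ {v ps} → Path S a v ps → LastRun v ps
  lastRun start = none
  lastRun (extend {p} {c} {ps} path p~c c∉ps) with adjacent⇒at c p (~-adjacent (~-sym p~c)) | lastRun path
  ... | d , refl | none = straight d 0 start refl
  ... | e , refl | straight {b} {qs} d x to-b turn with compareDir d e
  ...   | same refl =
    subst (λ c → LastRun c (c ∷ ps)) (sym (at-step b d (suc x))) (straight d (suc x) to-b turn)
  ...   | opposite e≡-d = contradiction
    (subst (_∈ ps) (sym (at-back b d e x e≡-d)) (there (head⇒∈ (head-line (path-head to-b) d x)))) c∉ps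
  ...   | perpendicular d⊥e = straight e 0 path turns
    where
    turns : Turn p e ps
    turns with line b d x ++ qs | head-line (path-head to-b) d x
    ... | _ ∷ rs | refl = segments-turn rs (trans (dot-steps b d e x) d⊥e)

data LastStep (c : Point) (ps : List Point) : Set where
  turns     : segments (c ∷ ps) ≡ suc (segments ps) → LastStep c ps
  continues : segments (c ∷ ps) ≡ segments ps → lastDir (c ∷ ps) ≡ lastDir ps →
              lastLength (c ∷ ps) ≡ suc (lastLength ps) → LastStep c ps

lastStep : ∀ {S a p c ps} → Path S a p ps → Path S a c (c ∷ ps) → LastStep c ps
lastStep p-path c-path = view p-path (lastRun c-path)
  where
  view : ∀ {S a p c ps} → Path S a p ps → LastRun {S} {a} c (c ∷ ps) → LastStep c ps
  view () none
  view _ (straight d zero _ turn) = turns turn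
  view _ (straight d (suc x) to-b turn) = continues
    (segments-line-suc (path-head to-b) d x)
    (trans (lastDir-line (path-head to-b) d (suc x)) (sym (lastDir-line (path-head to-b) d x)))
    (trans (lastLength-line (path-head to-b) d turn (suc x))
      (cong suc (sym (lastLength-line (path-head to-b) d turn x))))

record Induced (T : Shape) (P : Pred Point 0ℓ) (S : Shape) : Set where
  field
    nodes⇔ : ∀ p → p ∈ Shape.nodes S ⇔ P p
    edges⇔ : ∀ p q → Shape._~_ S p q ⇔ Restricted T P p q

  node⁺ : ∀ {p} → P p → p ∈ Shape.nodes S
  node⁺ = from (nodes⇔ _)

  node⁻ : ∀ {p} → p ∈ Shape.nodes S → P p
  node⁻ = to (nodes⇔ _)

  edge⁺ : ∀ {p q} → Restricted T P p q → Shape._~_ S p q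
  edge⁺ = from (edges⇔ _ _)

  edge⁻ : ∀ {p q} → Shape._~_ S p q → Restricted T P p q
  edge⁻ = to (edges⇔ _ _)

module _ {T : Shape} {P : Pred Point 0ℓ} {S : Shape} (S≡T∣P : Induced T P S) where

  open Induced S≡T∣P

  induced-resp-≐ : ∀ {Q} → P ≐ Q → Induced T Q S
  induced-resp-≐ (P⊆Q , Q⊆P) = record
    { nodes⇔ = λ p → mk⇔ (P⊆Q ∘ node⁻) (node⁺ ∘ Q⊆P)
    ; edges⇔ = λ p q → mk⇔
        (λ p~q → let p~q′ , Pp , Pq = edge⁻ p~q in p~q′ , P⊆Q Pp , P⊆Q Pq)
        (λ (p~q , Qp , Qq) → edge⁺ (p~q , Q⊆P Qp , Q⊆P Qq))
    }

  induced-path : ∀ {a b ps} → Path S a b ps → Path T a b ps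
  induced-path start               = start
  induced-path (extend p b~c c∉ps) = extend (induced-path p) (proj₁ (edge⁻ b~c)) c∉ps

  induced-tree : IsTree T → IsTree S
  induced-tree tree p 3≤length b~a = tree (induced-path p) 3≤length (proj₁ (edge⁻ b~a))

  induced-by-all : (∀ {p} → p ∈ Shape.nodes T → P p) → (∀ {p} → P p → p ∈ Shape.nodes T) → S ≋ T
  induced-by-all T⊆P P⊆T =
    (λ p → mk⇔ (P⊆T ∘ node⁻) (node⁺ ∘ T⊆P)) ,
    (λ p q → mk⇔ (proj₁ ∘ edge⁻) (λ p~q → edge⁺ (p~q , T⊆P (Shape.~-node T p~q) , T⊆P (~-nodeʳ {T} p~q))))

-- Bodies moving in one direction

module _ {S : Shape} (ops : Operations S) where

  open Operations ops

  edge-present : ∀ {x y} → Edge x y → Present x × Present y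
  edge-present (kept u~v _)           = Shape.~-node S u~v , ~-nodeʳ {S} u~v
  edge-present (grown op)             = op∈ op , op
  edge-present (spliced u~v (op , _)) = op , ~-nodeʳ {S} u~v

module UniformMotion {S : Shape} (ops : Operations S) (δ : Point → ℕ) where

  open Operations ops

  translate : Point → Point
  translate v = at v dir (δ v)

  shift : Body → ℕ
  shift (old v) = δ v
  shift (new u) = suc (δ u)

  final-at : ∀ x → final translate x ≡ at (initial x) dir (shift x)
  final-at (old v) = refl
  final-at (new u) = sym (at-suc u dir (δ u))

  δ≤shift : ∀ x → δ (initial x) ≤ shift x
  δ≤shift (old v) = ≤-refl
  δ≤shift (new u) = n≤1+n (δ u)

  same-body : ∀ x y → initial x ≡ initial y → shift x ≡ shift y → x ≡ y
  same-body (old _) (old _) refl _      = refl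
  same-body (new _) (new _) refl _      = refl
  same-body (old _) (new _) refl shift≡ = contradiction (sym shift≡) 1+n≢n
  same-body (new _) (old _) refl shift≡ = contradiction shift≡ 1+n≢n

  PushesAhead : Set
  PushesAhead = ∀ x t → Present x → suc t ≤ shift x → shift x ≤ δ (at (initial x) dir (suc t))

  pushesAhead⇒collision-free : PushesAhead →
    ∀ {x y} → Present x → Present y → x ≢ y → ∀ a r → 1 ≤ a →
    r • initial x ⊕ a • final translate x ≢ r • initial y ⊕ a • final translate y
  pushesAhead⇒collision-free ahead {x} {y} x-present y-present x≢y a r 1≤a eq =
    impossible (meeting a r 1≤a dir
      (subst₂ (λ p q → r • initial x ⊕ a • p ≡ r • initial y ⊕ a • q) (final-at x) (final-at y) eq))
    where
    never-catches : ∀ {x y} → Present x → ∀ t → initial y ≡ at (initial x) dir (suc t) →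
                    ¬ (suc t + shift y ≤ shift x)
    never-catches {x} {y} x-present t y≡ t+y≤x = <⇒≱ (m<n+m (shift y) {suc t} (s≤s z≤n)) (begin
      suc t + shift y                    ≤⟨ t+y≤x ⟩
      shift x                            ≤⟨ ahead x t x-present (m+n≤o⇒m≤o (suc t) t+y≤x) ⟩
      δ (at (initial x) dir (suc t))     ≡⟨ cong δ y≡ ⟨
      δ (initial y)                      ≤⟨ δ≤shift y ⟩
      shift y                            ∎)
      where open ≤-Reasoning
    impossible : ¬ Meeting dir (initial x) (shift x) (initial y) (shift y)
    impossible (together x≡y shift≡)  = x≢y (same-body x y x≡y shift≡)
    impossible (catching t y≡ t+y≤x) = never-catches {x} {y} x-present t y≡ t+y≤x
    impossible (caught t x≡ t+x≤y)   = never-catches {y} {x} y-present t x≡ t+x≤y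

-- Growing a tree phase by phase

steps : Dir → List Dir → ℕ
steps d ds = length (filter (d ≟ᵈ_) ds)

steps-same : ∀ d ds → steps d (d ∷ ds) ≡ suc (steps d ds)
steps-same d ds = cong length (filter-accept (d ≟ᵈ_) {xs = ds} refl)

steps-other : ∀ {d e} ds → e ≢ d → steps e (d ∷ ds) ≡ steps e ds
steps-other {e = e} ds e≢d = cong length (filter-reject (e ≟ᵈ_) {xs = ds} e≢d)

-- In a phase that grows the segments at distance i, ds lists the directions
-- of the steps made so far.
Reached : ℕ → List Dir → List Point → Set
Reached i ds ps = segments ps < i ⊎ (segments ps ≡ i × lastLength ps < 2 ^ steps (lastDir ps) ds)

reached? : ∀ i ds → Decidable (Reached i ds)
reached? i ds ps =
  (segments ps <? i) ⊎-dec ((segments ps ℕ.≟ i) ×-dec (lastLength ps <? 2 ^ steps (lastDir ps) ds))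

reached⇒segments≤ : ∀ {i ds} ps → Reached i ds ps → segments ps ≤ i
reached⇒segments≤ ps (inj₁ segments<i)       = <⇒≤ segments<i
reached⇒segments≤ ps (inj₂ (segments≡i , _)) = ≤-reflexive segments≡i

rounds : ℕ → List Dir
rounds zero    = []
rounds (suc n) = north ∷ east ∷ south ∷ west ∷ rounds n

steps-rounds : ∀ d n → steps d (rounds n) ≡ n
steps-rounds d     zero    = refl
steps-rounds north (suc n) = cong suc (steps-rounds north n)
steps-rounds east  (suc n) = cong suc (steps-rounds east n)
steps-rounds south (suc n) = cong suc (steps-rounds south n)
steps-rounds west  (suc n) = cong suc (steps-rounds west n)

length-rounds : ∀ n → length (rounds n) ≡ n * 4
length-rounds zero    = refl
length-rounds (suc n) = cong (4 ℕ.+_) (length-rounds n)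

module Tree (T : Shape) (tree : IsTree T) (u₀ : Point) (u₀∈ : u₀ ∈ Shape.nodes T) where

  open Shape T using (nodes; size; _~_; _~?_; ~-sym; ~-node; ~-adjacent)

  RootPath : Point → List Point → Set
  RootPath = Path T u₀

  path-to : ∀ {v} → v ∈ nodes → ∃[ ps ] RootPath v ps
  path-to v∈ =
    let ps , p , _ = loopErase {P = λ _ → ⊤} start (tt ∷ []) (Star.map (_, tt , tt) (Shape.connected T u₀∈ v∈))
    in ps , p

  path-unique : ∀ {v ps qs} → RootPath v ps → RootPath v qs → ps ≡ qs
  path-unique start start = refl
  path-unique start (extend q _ u₀∉) = contradiction (path-start∈ q) u₀∉
  path-unique (extend p _ u₀∉) start = contradiction (path-start∈ p) u₀∉
  path-unique {c} (extend {b} {ps = ps} p b~c c∉ps) (extend {b′} {ps = qs} q b′~c c∉qs) with b ≟ b′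
  ... | yes refl = cong (c ∷_) (path-unique p q)
  ... | no b≢b′  = contradiction detour no-detour
    where
    detour : ∃[ rs ] Path T b b′ rs × All (c ≢_) rs
    detour = loopErase start (All.lookup (¬Any⇒All¬ ps c∉ps) (path-end∈ p) ∷ [])
      (Star.reverse (restricted-sym {S = T}) (path⇒walk p (¬Any⇒All¬ ps c∉ps)) ◅◅ path⇒walk q (¬Any⇒All¬ qs c∉qs))
    no-detour : ¬ (∃[ rs ] Path T b b′ rs × All (c ≢_) rs)
    no-detour (_ , start , _) = b≢b′ refl
    no-detour (_ , r@(extend r′ _ _) , c∉rs) =
      tree (extend r b′~c (All¬⇒¬Any c∉rs)) (s≤s (s≤s (∈-length (path-end∈ r′)))) (~-sym b~c)

  infix 4 _⊲_

  _⊲_ : Rel Point 0ℓ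
  p ⊲ c = ∃[ ps ] RootPath p ps × RootPath c (c ∷ ps)

  ⊲⇒~ : ∀ {p c} → p ⊲ c → p ~ c
  ⊲⇒~ (_ , p-path , c-path) = proj₁ (proj₂ (path-tail c-path (path-head p-path)))

  ⊲-asym : ∀ {p c} → p ⊲ c → ¬ c ⊲ p
  ⊲-asym (_ , p-path , c-path) (_ , c-path′ , p-path′) with refl ← path-unique p-path p-path′ =
    proj₂ (proj₂ (path-tail c-path refl)) (there (path-end∈ c-path′))

  parent-unique : ∀ {p p′ c} → p ⊲ c → p′ ⊲ c → p ≡ p′
  parent-unique (_ , p-path , c-path) (_ , p′-path , c-path′) with refl ← path-unique c-path c-path′ =
    path-end-unique p-path p′-path

  ~⇒⊲ : ∀ {p q} → p ~ q → p ⊲ q ⊎ q ⊲ p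
  ~⇒⊲ {p} {q} p~q with path-to (~-node p~q)
  ... | ps , p-path with q ∈? ps
  ...   | no  q∉ps = inj₁ (ps , p-path , extend p-path p~q q∉ps)
  ...   | yes q∈ps = inj₂ (parent p-path q∈ps)
    where
    parent : ∀ {ps} → RootPath p ps → q ∈ ps → q ⊲ p
    parent start              (here q≡p) = contradiction (sym q≡p) (~-irrefl {T} p~q)
    parent (extend _ _ _)     (here q≡p) = contradiction (sym q≡p) (~-irrefl {T} p~q)
    parent (extend path _ p∉) (there q∈) =
      let qs , q-path , qs⊆ = truncate path q∈ in qs , q-path , extend q-path (~-sym p~q) (p∉ ∘ qs⊆)

  HasRootPath : Pred (List Point) 0ℓ → Pred Point 0ℓ
  HasRootPath R v = ∃[ ps ] RootPath v ps × R ps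

  root-path-satisfies : ∀ {R v ps} → RootPath v ps → HasRootPath R v → R ps
  root-path-satisfies p (_ , q , Rq) with refl ← path-unique p q = Rq

  hasRootPath⇒node : ∀ {R v} → HasRootPath R v → v ∈ nodes
  hasRootPath⇒node (_ , p , _) = path⊆nodes u₀∈ p (path-end∈ p)

  hasRootPath? : ∀ {R} → Decidable R → Decidable (HasRootPath R)
  hasRootPath? R? v with v ∈? nodes
  ... | no  v∉ = no (v∉ ∘ hasRootPath⇒node)
  ... | yes v∈ = let ps , p = path-to v∈ in map′ (λ Rps → ps , p , Rps) (root-path-satisfies p) (R? ps)

  module _ {P : Pred Point 0ℓ} (P? : Decidable P) (P⇒node : ∀ {p} → P p → p ∈ nodes)
           (P-parent : ∀ {p c} → p ⊲ c → P c → P p) where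

    private
      from-root : ∀ {v ps} → RootPath v ps → P v → Star (Restricted T P) u₀ v
      from-root start _ = ε
      from-root path@(extend p p~c _) Pc = from-root p Pp ◅◅ (p~c , Pp , Pc) ◅ ε
        where
        Pp : P _
        Pp = P-parent (_ , p , path) Pc

      connect : ∀ {v} → v ∈ filter P? nodes → Star (Restricted T P) u₀ v
      connect v∈ =
        let v∈T , Pv = ∈-filter⁻ P? {xs = nodes} v∈ in from-root (proj₂ (path-to v∈T)) Pv

    subtree : Shape
    subtree = record
      { nodes      = filter P? nodes
      ; distinct   = Unique.filter⁺ P? (Shape.distinct T)
      ; _~_        = Restricted T P
      ; _~?_       = λ p q → (p ~? q) ×-dec (P? p ×-dec P? q)
      ; ~-sym      = restricted-sym {S = T}
      ; ~-node     = λ (p~q , Pp , _) → ∈-filter⁺ P? (~-node p~q) Pp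
      ; ~-adjacent = ~-adjacent ∘ proj₁
      ; connected  = λ p∈ q∈ → Star.reverse (restricted-sym {S = T}) (connect p∈) ◅◅ connect q∈
      }

    subtree-induced : Induced T P subtree
    subtree-induced = record
      { nodes⇔ = λ p → mk⇔ (proj₂ ∘ ∈-filter⁻ P? {xs = nodes}) (λ Pp → ∈-filter⁺ P? (P⇒node Pp) Pp)
      ; edges⇔ = λ p q → mk⇔ id id
      }

  module _ (i : ℕ) (ds : List Dir) where

    Grown : Pred Point 0ℓ
    Grown = HasRootPath (Reached i ds)

    grown-parent : ∀ {p c} → p ⊲ c → Grown c → Grown p
    grown-parent (ps , p-path , c-path) c-grown =
      ps , p-path , parent-reached (lastStep p-path c-path) (root-path-satisfies c-path c-grown)
      where
      parent-reached : ∀ {c} → LastStep c ps → Reached i ds (c ∷ ps) → Reached i ds ps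
      parent-reached {c} (turns turn) reached =
        inj₁ (≤-trans (≤-reflexive (sym turn)) (reached⇒segments≤ {i} {ds} (c ∷ ps) reached))
      parent-reached (continues same-segments same-dir 1+length) = Sum.map
        (subst (_< i) same-segments)
        (λ (segments≡i , length<2^s) → trans (sym same-segments) segments≡i ,
          <-trans (n<1+n (lastLength ps)) (subst₂ (λ r e → r < 2 ^ steps e ds) 1+length same-dir length<2^s))

    grown⇒within : ∀ {v} → Grown v → Within T u₀ i v
    grown⇒within (ps , p , reached) = ps , p , reached⇒segments≤ {i} {ds} ps reached

    grown? : Decidable Grown
    grown? = hasRootPath? (reached? i ds)

    stage : Shape
    stage = subtree grown? hasRootPath⇒node grown-parent

    stage-induced : Induced T Grown stage
    stage-induced = subtree-induced grown? hasRootPath⇒node grown-parent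

  module Segments (j : ℕ) (d : Dir) where

    record MaximalSegment : Set where
      field
        {base}  : Point
        {len}   : ℕ
        segment : Segment T u₀ (suc j) base d len

      open Segment segment public

      node : ℕ → Point
      node = at base d

      nodePath : ℕ → List Point
      nodePath x = line base d x ++ before

      before-head : head before ≡ just base
      before-head = path-head path-to-base

      path : ∀ {x} → x ≤ len → RootPath (node x) (nodePath x)
      path x≤len = straight-prefix before-head x≤len path-to-end

      edge : ∀ {x} → x < len → node x ⊲ node (suc x)
      edge {x} x<len = nodePath x , path (<⇒≤ x<len) , path x<len

      path⇒≤len : ∀ {x} → RootPath (node x) (nodePath x) → x ≤ len
      path⇒≤len p = ≮⇒≥ λ len<x →
        maximal (proj₂ (straight-tail before-head (straight-prefix before-head len<x p)))

      turn : Turn base d before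
      turn = trans (sym (segments-line before-head d len nonempty)) (trans end-dist (sym base-dist))

      segments-base : segments before ≡ j
      segments-base = suc-injective base-dist

      segments-node : ∀ x → segments (nodePath (suc x)) ≡ suc j
      segments-node x = trans (segments-line before-head d (suc x) (s≤s z≤n)) (trans turn base-dist)

      lastLength-node : ∀ x → lastLength (nodePath (suc x)) ≡ suc x
      lastLength-node = lastLength-line before-head d turn

      lastDir-node : ∀ x → lastDir (nodePath (suc x)) ≡ d
      lastDir-node = lastDir-line before-head d

    open MaximalSegment

    maximize : ∀ {b ps x} → RootPath b ps → segments ps ≡ j → Turn b d ps →
               RootPath (at b d (suc x)) (line b d (suc x) ++ ps) →
               ∃[ m ] suc x ≤ m × Segment T u₀ (suc j) b d m
    maximize {b} {ps} to-b segments≡j turn path = path-rec u₀∈ Extendable extendable path refl refl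
      where
      Extendable : Point → List Point → Set
      Extendable v qs = ∀ {x} → v ≡ at b d (suc x) → qs ≡ line b d (suc x) ++ ps →
                        ∃[ m ] suc x ≤ m × Segment T u₀ (suc j) b d m
      extendable : ∀ {v qs} → RootPath v qs →
                   (∀ {w} → RootPath w (w ∷ qs) → Extendable w (w ∷ qs)) → Extendable v qs
      extendable p from-longer {x} refl refl with at b d (suc x) ~? at b d (2 + x)
      ... | no maximal = suc x , ≤-refl , record
        { nonempty     = s≤s z≤n
        ; before       = ps
        ; path-to-base = to-b
        ; path-to-end  = p
        ; base-dist    = cong suc segments≡j
        ; end-dist     =
            trans (segments-line (path-head to-b) d (suc x) (s≤s z≤n)) (trans turn (cong suc segments≡j))
        ; maximal      = maximal
        }
      ... | yes edge with ~⇒⊲ edge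
      ...   | inj₁ (_ , p′ , longer) with refl ← path-unique p p′ =
        let m , 2+x≤m , segment = from-longer longer refl refl in m , <⇒≤ 2+x≤m , segment
      ...   | inj₂ back = contradiction (at-injective b d {2 + x} (parent-unique back ahead)) (m≢1+n+m x ∘ sym)
        where
        ahead : at b d x ⊲ at b d (suc x)
        ahead = line b d x ++ ps , proj₁ (straight-tail (path-head to-b) p) , p

    nodePath-injective : ∀ s s′ x x′ → nodePath s x ≡ nodePath s′ x′ → x ≡ x′
    nodePath-injective s s′ zero    zero     _      = refl
    nodePath-injective s s′ zero    (suc x′) paths≡ = contradiction
      (trans (sym (segments-node s′ x′)) (trans (cong segments (sym paths≡)) (segments-base s))) 1+n≢n
    nodePath-injective s s′ (suc x) zero     paths≡ = contradiction
      (trans (sym (segments-node s x)) (trans (cong segments paths≡) (segments-base s′))) 1+n≢n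
    nodePath-injective s s′ (suc x) (suc x′) paths≡ =
      trans (sym (lastLength-node s x)) (trans (cong lastLength paths≡) (lastLength-node s′ x′))

    nodePath≡⇒len≤ : ∀ s s′ x → nodePath s x ≡ nodePath s′ x → len s ≤ len s′
    nodePath≡⇒len≤ s s′ x paths≡ = path⇒≤len s′ (subst₂ (λ b ps → RootPath (at b d (len s)) (line b d (len s) ++ ps))
      base≡ before≡ (path-to-end s))
      where
      before≡ : before s ≡ before s′
      before≡ = line-++-cancel (base s) (base s′) d x paths≡
      base≡ : base s ≡ base s′
      base≡ = just-injective (trans (sym (before-head s)) (trans (cong head before≡) (before-head s′)))

    segment-unique : ∀ s s′ {x x′} → x ≤ len s → x′ ≤ len s′ → node s x ≡ node s′ x′ →
                     x ≡ x′ × len s ≡ len s′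
    segment-unique s s′ {x} {x′} x≤len x′≤len node≡
      with paths≡ ← path-unique (path s x≤len)
                      (subst (λ p → RootPath p (nodePath s′ x′)) (sym node≡) (path s′ x′≤len))
      with refl ← nodePath-injective s s′ x x′ paths≡ =
      refl , ≤-antisym (nodePath≡⇒len≤ s s′ x paths≡) (nodePath≡⇒len≤ s′ s x (sym paths≡))

    OnSegment : Pred Point 0ℓ
    OnSegment v = ∃[ s ] ∃[ x ] x ≤ len s × v ≡ node s x

    BeyondBase : Pred Point 0ℓ
    BeyondBase v = ∃[ s ] ∃[ x ] x < len s × v ≡ node s (suc x)

    EndsInDirection : Pred (List Point) 0ℓ
    EndsInDirection ps = segments ps ≡ suc j × lastDir ps ≡ d

    beyondBase⁺ : ∀ {v} → HasRootPath EndsInDirection v → BeyondBase v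
    beyondBase⁺ (ps , p , segments≡ , dir≡) with lastRun p
    ... | straight {ps = qs} e x to-b turn with refl ← trans (sym (lastDir-line (path-head to-b) e x)) dir≡ =
      let m , x<m , segment = maximize to-b segments≡j turn p
      in record { segment = segment } , x , x<m , refl
      where
      segments≡j : segments qs ≡ j
      segments≡j = suc-injective
        (trans (sym turn) (trans (sym (segments-line (path-head to-b) e (suc x) (s≤s z≤n))) segments≡))

    beyondBase⁻ : ∀ {v} → BeyondBase v → HasRootPath EndsInDirection v
    beyondBase⁻ (s , x , x<len , refl) = nodePath s (suc x) , path s x<len , segments-node s x , lastDir-node s x

    beyondBase? : Decidable BeyondBase
    beyondBase? v = map′ beyondBase⁺ beyondBase⁻
      (hasRootPath? (λ ps → (segments ps ℕ.≟ suc j) ×-dec (lastDir ps ≟ᵈ d)) v)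

    onSegment? : Decidable OnSegment
    onSegment? v = map′ on⁺ on⁻ (beyondBase? v ⊎-dec beyondBase? (at v d 1))
      where
      on⁺ : BeyondBase v ⊎ BeyondBase (at v d 1) → OnSegment v
      on⁺ (inj₁ (s , x , x<len , v≡)) = s , suc x , x<len , v≡
      on⁺ (inj₂ (s , x , x<len , next≡)) =
        s , x , <⇒≤ x<len , ⊕-cancelʳ (1 • vec d) (trans next≡ (sym (at-step (base s) d x)))
      on⁻ : OnSegment v → BeyondBase v ⊎ BeyondBase (at v d 1)
      on⁻ (s , suc x , x<len , v≡)  = inj₁ (s , x , x<len , v≡)
      on⁻ (s , zero  , _     , refl) = inj₂ (s , 0 , nonempty s , at-step (base s) d 0)

    node-grown⁺ : ∀ {ds} s {x} → x < extent (steps d ds) (len s) → Grown (suc j) ds (node s x)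
    node-grown⁺ {ds} s {x} x<extent =
      nodePath s x , path s (<extent⇒≤ (steps d ds) x<extent) ,
      reached x (<-≤-trans x<extent (m⊓n≤n (suc (len s)) (2 ^ steps d ds)))
      where
      reached : ∀ x → x < 2 ^ steps d ds → Reached (suc j) ds (nodePath s x)
      reached zero    _     = inj₁ (s≤s (≤-reflexive (segments-base s)))
      reached (suc x) x<2^s = inj₂ (segments-node s x ,
        subst₂ (λ r e → r < 2 ^ steps e ds) (sym (lastLength-node s x)) (sym (lastDir-node s x)) x<2^s)

    node-grown⁻ : ∀ {ds} s {x} → x ≤ len s → Grown (suc j) ds (node s x) → x < extent (steps d ds) (len s)
    node-grown⁻ {ds} s {x} x≤len x-grown =
      ⊓-glb (s≤s x≤len) (bound x (root-path-satisfies (path s x≤len) x-grown))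
      where
      bound : ∀ x → Reached (suc j) ds (nodePath s x) → x < 2 ^ steps d ds
      bound zero    _                    = m^n>0 2 (steps d ds)
      bound (suc x) (inj₁ segments<1+j)  = contradiction (segments-node s x) (<⇒≢ segments<1+j)
      bound (suc x) (inj₂ (_ , length<2^s)) =
        subst₂ (λ r e → r < 2 ^ steps e ds) (lastLength-node s x) (lastDir-node s x) length<2^s

    grown-off-segment : ∀ {es es′ v} → (∀ {e} → e ≢ d → steps e es ≡ steps e es′) →
                        ¬ BeyondBase v → Grown (suc j) es v → Grown (suc j) es′ v
    grown-off-segment steps≡ ¬beyond (ps , p , inj₁ segments≤j) = ps , p , inj₁ segments≤j
    grown-off-segment steps≡ ¬beyond (ps , p , inj₂ (segments≡ , length<2^s)) =
      ps , p , inj₂ (segments≡ , subst (λ s → lastLength ps < 2 ^ s) (steps≡ dir≢d) length<2^s)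
      where
      dir≢d : lastDir ps ≢ d
      dir≢d dir≡d = ¬beyond (beyondBase⁺ (ps , p , segments≡ , dir≡d))

    data Position : Point → Set where
      beyond : ∀ s x → x < len s → Position (node s (suc x))
      off    : ∀ {v} → ¬ BeyondBase v → Position v

    position : ∀ v → Position v
    position v with beyondBase? v
    ... | yes (s , x , x<len , refl) = beyond s x x<len
    ... | no ¬beyond                 = off ¬beyond

    data EdgeView : Point → Point → Set where
      along : ∀ s x → x < len s → EdgeView (node s x) (node s (suc x))
      off   : ∀ {p c} → ¬ BeyondBase p → ¬ BeyondBase c → EdgeView p c

    edgeView : ∀ {p c} → p ⊲ c → Within T u₀ (suc j) c → EdgeView p c
    edgeView {p} {c} p⊲c@(ps , p-path , c-path) c-within with position c
    ... | beyond s x x<len with refl ← parent-unique p⊲c (edge s x<len) = along s x x<len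
    ... | off ¬c-beyond = off ¬p-beyond ¬c-beyond
      where
      ¬p-beyond : ¬ BeyondBase p
      ¬p-beyond p-beyond with root-path-satisfies p-path (beyondBase⁻ p-beyond) | lastStep p-path c-path
      ... | segments≡ , _    | turns turn =
        1+n≰n (≤-trans (≤-reflexive (sym (trans turn (cong suc segments≡)))) (root-path-satisfies c-path c-within))
      ... | segments≡ , dir≡ | continues same-segments same-dir _ =
        ¬c-beyond (beyondBase⁺ (_ , c-path , trans same-segments segments≡ , trans same-dir dir≡))

  -- One time step

  module Doubling (j : ℕ) (d : Dir) (ds : List Dir) where

    open Segments j d
    open MaximalSegment

    Before After : Pred Point 0ℓ
    Before = Grown (suc j) ds
    After  = Grown (suc j) (d ∷ ds)

    shown quota : MaximalSegment → ℕ
    shown s = extent (steps d ds) (len s)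
    quota s = growth (steps d ds) (len s)

    <quota⇒<len : ∀ s {y} → y < quota s → y < len s
    <quota⇒<len _ = <growth⇒< (steps d ds)

    new≤len : ∀ s {y} → y < quota s → suc (y + y) ≤ len s
    new≤len _ y<q = <extent⇒≤ (suc (steps d ds)) (<growth⇒1+y+y<extent (steps d ds) y<q)

    stretch≤len : ∀ s {x} → x < shown s → stretch (quota s) x ≤ len s
    stretch≤len _ x<shown = <extent⇒≤ (suc (steps d ds)) (stretch<extent (steps d ds) x<shown)

    node-before⁺ : ∀ s {x} → x < shown s → Before (node s x)
    node-before⁺ = node-grown⁺ {ds}

    node-before⁻ : ∀ s {x} → x ≤ len s → Before (node s x) → x < shown s
    node-before⁻ = node-grown⁻ {ds}

    node-after⁺ : ∀ s {z} → z < extent (suc (steps d ds)) (len s) → After (node s z)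
    node-after⁺ s {z} z<extent = node-grown⁺ {d ∷ ds} s
      (subst (λ n → z < extent n (len s)) (sym (steps-same d ds)) z<extent)

    node-after⁻ : ∀ s {z} → z ≤ len s → After (node s z) → z < extent (suc (steps d ds)) (len s)
    node-after⁻ s {z} z≤len z-after =
      subst (λ n → z < extent n (len s)) (steps-same d ds) (node-grown⁻ {d ∷ ds} s z≤len z-after)

    off-segment : ∀ {v} → ¬ BeyondBase v → Before v ⇔ After v
    off-segment ¬beyond = mk⇔
      (grown-off-segment {ds} {d ∷ ds} (sym ∘ steps-other ds) ¬beyond)
      (grown-off-segment {d ∷ ds} {ds} (steps-other ds) ¬beyond)

    Op : Pred Point 0ℓ
    Op u = ∃[ s ] ∃[ y ] y < quota s × u ≡ node s y

    op-node⁻ : ∀ s {x} → x ≤ len s → Op (node s x) → x < quota s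
    op-node⁻ s x≤len (s′ , y , y<q , node≡)
      with refl , len≡ ← segment-unique s s′ x≤len (<⇒≤ (<quota⇒<len s′ y<q)) node≡ =
      subst (λ n → y < growth (steps d ds) n) (sym len≡) y<q

    op? : Decidable Op
    op? u with onSegment? u
    ... | yes (s , x , x≤len , refl) = map′ (λ x<q → s , x , x<q , refl) (op-node⁻ s x≤len) (x <? quota s)
    ... | no ¬on = no λ (s , y , y<q , u≡) → ¬on (s , y , <⇒≤ (<quota⇒<len s y<q) , u≡)

    op-before : ∀ {u} → Op u → Before u
    op-before (s , y , y<q , refl) = node-before⁺ s (<growth⇒<extent (steps d ds) y<q)

    δ : Point → ℕ
    δ v with onSegment? v
    ... | yes (s , x , _) = x ⊓ quota s
    ... | no  _           = 0

    δ-node : ∀ s {x} → x ≤ len s → δ (node s x) ≡ x ⊓ quota s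
    δ-node s {x} x≤len with onSegment? (node s x)
    ... | no ¬on = contradiction (s , x , x≤len , refl) ¬on
    ... | yes (s′ , x′ , x′≤len , node≡) with segment-unique s s′ x≤len x′≤len node≡
    ...   | refl , len≡ = cong (λ n → x ⊓ growth (steps d ds) n) (sym len≡)

    δ-off : ∀ {v} → ¬ BeyondBase v → δ v ≡ 0
    δ-off {v} ¬beyond with onSegment? v
    ... | no _                         = refl
    ... | yes (s , zero  , _     , _)  = refl
    ... | yes (s , suc x , x<len , v≡) = contradiction (s , x , x<len , v≡) ¬beyond

    module _ {S S′ : Shape} (S-before : Induced T Before S) (S′-after : Induced T After S′) where

      private
        module Before = Induced S-before
        module After  = Induced S′-after

      ops : Operations S
      ops = record { dir = d ; Op = Op ; op? = op? ; op∈ = Before.node⁺ ∘ op-before }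

      open Operations ops hiding (dir; Op; op?; op∈)
      open UniformMotion ops δ

      translate-node : ∀ s {x} → x ≤ len s → translate (node s x) ≡ node s (stretch (quota s) x)
      translate-node s {x} x≤len =
        trans (cong (at (node s x) d) (δ-node s x≤len)) (at-+ (base s) d x (x ⊓ quota s))

      translate-off : ∀ {v} → ¬ BeyondBase v → translate v ≡ v
      translate-off {v} ¬beyond = trans (cong (at v d) (δ-off ¬beyond)) (at-zero v d)

      translate-op : ∀ s {y} → y < quota s → translate (node s y) ≡ node s (y + y)
      translate-op s y<q =
        trans (translate-node s (<⇒≤ (<quota⇒<len s y<q))) (cong (node s) (stretch-≤ (<⇒≤ y<q)))

      translate-next : ∀ s {y} → y < quota s → translate (node s (suc y)) ≡ node s (2 + (y + y))
      translate-next s y<q = trans (translate-node s (<quota⇒<len s y<q)) (cong (node s) (stretch-suc-≤ y<q))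

      translate-unsplit : ∀ s {x} → x ≤ len s → quota s ≤ x → translate (node s x) ≡ node s (x + quota s)
      translate-unsplit s x≤len q≤x = trans (translate-node s x≤len) (cong (node s) (stretch-≥ q≤x))

      final-new : ∀ s {y} → y < quota s → translate (node s y) ⊕ vec d ≡ node s (suc (y + y))
      final-new s {y} y<q =
        trans (cong (_⊕ vec d) (translate-op s y<q)) (sym (at-suc (base s) d (y + y)))

      toward-next : ∀ s {y} → y < quota s → Toward (node s y) (node s (suc y))
      toward-next s {y} y<q = (s , y , y<q , refl) , at-suc (base s) d y

      toward⁻ : ∀ {u v} → Toward u v → ∃[ s ] ∃[ y ] y < quota s × u ≡ node s y × v ≡ node s (suc y)
      toward⁻ ((s , y , y<q , u≡) , refl) =
        s , y , y<q , u≡ , trans (cong (_⊕ vec d) u≡) (sym (at-suc (base s) d y))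

      splits⇒toward : ∀ {p c} → p ⊲ c → Splits p c → Toward p c
      splits⇒toward p⊲c (inj₁ toward) = toward
      splits⇒toward p⊲c (inj₂ toward) with s , y , y<q , refl , refl ← toward⁻ toward =
        contradiction (edge s (<quota⇒<len s y<q)) (⊲-asym p⊲c)

      splits⇒beyondBase : ∀ {p c} → p ⊲ c → Splits p c → BeyondBase c
      splits⇒beyondBase p⊲c splits with s , y , y<q , _ , c≡ ← toward⁻ (splits⇒toward p⊲c splits) =
        s , y , <quota⇒<len s y<q , c≡

      splits⇒<quota : ∀ s {x} → x < len s → Splits (node s x) (node s (suc x)) → x < quota s
      splits⇒<quota s x<len splits = op-node⁻ s (<⇒≤ x<len) (proj₁ (splits⇒toward (edge s x<len) splits))

      root-not-beyondBase : ¬ BeyondBase u₀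
      root-not-beyondBase u₀-beyond =
        contradiction (proj₁ (root-path-satisfies start (beyondBase⁻ u₀-beyond))) 0≢1+n

      push : Point → Point → Point
      push p c = if does (splits? p c) then c ⊖ p else origin

      push-toward : ∀ {p c} → Toward p c → push p c ≡ vec d
      push-toward {p} toward@(_ , refl) =
        trans (if-yes (splits? p (p ⊕ vec d)) (inj₁ toward)) ([p⊕v]⊖p≡v p (vec d))

      push-unsplit : ∀ {p c} → ¬ Splits p c → δ p ≡ δ c → push p c ⊕ δ p • vec d ≡ δ c • vec d
      push-unsplit {p} {c} ¬splits δp≡δc = begin
        push p c ⊕ δ p • vec d     ≡⟨ cong (_⊕ δ p • vec d) (if-no (splits? p c) ¬splits) ⟩
        origin ⊕ δ p • vec d       ≡⟨ ⊕-identityˡ (δ p • vec d) ⟩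
        δ p • vec d                ≡⟨ cong (_• vec d) δp≡δc ⟩
        δ c • vec d                ∎
        where open ≡-Reasoning

      push-δ : ∀ {p c} → p ⊲ c → EdgeView p c → push p c ⊕ δ p • vec d ≡ δ c • vec d
      push-δ p⊲c (off ¬p-beyond ¬c-beyond) =
        push-unsplit (¬c-beyond ∘ splits⇒beyondBase p⊲c) (trans (δ-off ¬p-beyond) (sym (δ-off ¬c-beyond)))
      push-δ p⊲c (along s x x<len) with x <? quota s
      ... | no x≮q = push-unsplit (x≮q ∘ splits⇒<quota s x<len) (begin
        δ (node s x)               ≡⟨ δ-node s (<⇒≤ x<len) ⟩
        x ⊓ quota s                ≡⟨ suc-⊓-≥ (≮⇒≥ x≮q) ⟨
        suc x ⊓ quota s            ≡⟨ δ-node s x<len ⟨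
        δ (node s (suc x))         ∎)
        where open ≡-Reasoning
      ... | yes x<q = begin
        push (node s x) (node s (suc x)) ⊕ δ (node s x) • vec d
          ≡⟨ cong₂ (λ v n → v ⊕ n • vec d) (push-toward (toward-next s x<q)) (δ-node s (<⇒≤ x<len)) ⟩
        vec d ⊕ (x ⊓ quota s) • vec d
          ≡⟨ •-suc (x ⊓ quota s) (vec d) ⟨
        suc (x ⊓ quota s) • vec d
          ≡⟨ cong (_• vec d) (suc-⊓-< x<q) ⟨
        (suc x ⊓ quota s) • vec d
          ≡⟨ cong (_• vec d) (δ-node s x<len) ⟨
        δ (node s (suc x)) • vec d ∎
        where open ≡-Reasoning

      displacement≡δ : ∀ {v ps} → Path S u₀ v ps → displacement ps ≡ δ v • vec d
      displacement≡δ start = cong (_• vec d) (sym (δ-off root-not-beyondBase))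
      displacement≡δ (extend {c = c} {ps = p ∷ ps} path p~c c∉ps)
        with refl ← just-injective (path-head path) = begin
        push p c ⊕ displacement (p ∷ ps)   ≡⟨ cong (push p c ⊕_) (displacement≡δ path) ⟩
        push p c ⊕ δ p • vec d             ≡⟨ push-δ p⊲c (edgeView p⊲c c-within) ⟩
        δ c • vec d                        ∎
        where
        open ≡-Reasoning
        p⊲c : p ⊲ c
        p⊲c = p ∷ ps , induced-path S-before path , induced-path S-before (extend path p~c c∉ps)
        c-within : Within T u₀ (suc j) c
        c-within = grown⇒within (suc j) ds (proj₂ (proj₂ (Before.edge⁻ p~c)))

      node-present⁻ : ∀ s {x} → x ≤ len s → node s x ∈ Shape.nodes S → x < shown s
      node-present⁻ s x≤len x∈ = node-before⁻ s x≤len (Before.node⁻ x∈)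

      pushesAhead : PushesAhead
      pushesAhead (old v) t v∈ t<δ with position v
      ... | off ¬beyond = contradiction (subst (suc t ≤_) (δ-off ¬beyond) t<δ) λ ()
      ... | beyond s x x<len = begin
        δ (node s (suc x))                ≡⟨ δ≡ ⟩
        suc x ⊓ quota s                   ≤⟨ ⊓-monoˡ-≤ (quota s) (m≤m+n (suc x) (suc t)) ⟩
        (suc x + suc t) ⊓ quota s         ≡⟨ δ-node s x+t≤len ⟨
        δ (node s (suc x + suc t))        ≡⟨ cong δ (at-+ (base s) d (suc x) (suc t)) ⟨
        δ (at (node s (suc x)) d (suc t)) ∎
        where
        open ≤-Reasoning
        δ≡ : δ (node s (suc x)) ≡ suc x ⊓ quota s
        δ≡ = δ-node s x<len
        x+t≤len : suc x + suc t ≤ len s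
        x+t≤len = ≤-trans (+-monoʳ-≤ (suc x) (subst (suc t ≤_) δ≡ t<δ))
          (stretch≤len s (node-present⁻ s x<len v∈))
      pushesAhead (new u) t (s , y , y<q , refl) t≤δ = begin
        suc (δ (node s y))                ≡⟨ cong suc δ≡ ⟩
        suc y                             ≤⟨ ⊓-glb (subst (suc y ≤_) (sym (+-suc y t)) (s≤s (m≤m+n y t))) y<q ⟩
        (y + suc t) ⊓ quota s             ≡⟨ δ-node s y+t≤len ⟨
        δ (node s (y + suc t))            ≡⟨ cong δ (at-+ (base s) d y (suc t)) ⟨
        δ (at (node s y) d (suc t))       ∎
        where
        open ≤-Reasoning
        δ≡ : δ (node s y) ≡ y
        δ≡ = trans (δ-node s (<⇒≤ (<quota⇒<len s y<q))) (m≤n⇒m⊓n≡m (<⇒≤ y<q))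
        y+t≤len : y + suc t ≤ len s
        y+t≤len = ≤-trans (+-monoʳ-≤ y (subst (suc t ≤_) (cong suc δ≡) t≤δ))
          (subst (_≤ len s) (sym (+-suc y y)) (new≤len s y<q))

      final-after : ∀ x → Present x → After (final translate x)
      final-after (old v) v∈ with position v
      ... | off ¬beyond =
        subst After (sym (translate-off ¬beyond)) (to (off-segment ¬beyond) (Before.node⁻ v∈))
      ... | beyond s x x<len = subst After (sym (translate-node s x<len))
        (node-after⁺ s (stretch<extent (steps d ds) (node-present⁻ s x<len v∈)))
      final-after (new u) (s , y , y<q , refl) = subst After (sym (final-new s y<q))
        (node-after⁺ s (<growth⇒1+y+y<extent (steps d ds) y<q))

      Link : Rel Point 0ℓ
      Link p q = ∃[ x ] ∃[ y ] SymClosure Edge x y × final translate x ≡ p × final translate y ≡ q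

      link-sym : ∀ {p q} → Link p q → Link q p
      link-sym (x , y , e , x≡ , y≡) = y , x , symmetric Edge e , y≡ , x≡

      segment-edge : ∀ s {x} → suc x < shown s → Shape._~_ S (node s x) (node s (suc x))
      segment-edge s {x} 1+x<shown = Before.edge⁺
        ( ⊲⇒~ (edge s (<extent⇒≤ (steps d ds) 1+x<shown))
        , node-before⁺ s (<-trans (n<1+n x) 1+x<shown)
        , node-before⁺ s 1+x<shown )

      segment-link : ∀ s {z} → suc z < extent (suc (steps d ds)) (len s) → Link (node s z) (node s (suc z))
      segment-link s {z} 1+z<extent with edgeOrigin (growth≤extent (steps d ds) (len s))
        (subst (suc z <_) (sym (extent+growth (steps d ds) (len s))) 1+z<extent)
      ... | kept x q≤x 1+x<shown =
        old (node s x) , old (node s (suc x)) , fwd (kept (segment-edge s 1+x<shown) ¬splits) ,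
        translate-unsplit s (<⇒≤ x<len) q≤x ,
        translate-unsplit s x<len (m≤n⇒m≤1+n q≤x)
        where
        x<len : x < len s
        x<len = <extent⇒≤ (steps d ds) 1+x<shown
        ¬splits : ¬ Splits (node s x) (node s (suc x))
        ¬splits = ≤⇒≯ q≤x ∘ splits⇒<quota s x<len
      ... | grown y y<q =
        old (node s y) , new (node s y) , fwd (grown (s , y , y<q , refl)) ,
        translate-op s y<q ,
        final-new s y<q
      ... | spliced y y<q 1+y<shown =
        new (node s y) , old (node s (suc y)) , fwd (spliced (segment-edge s 1+y<shown) (toward-next s y<q)) ,
        final-new s y<q ,
        translate-next s y<q

      parent-link : ∀ {p c} → p ⊲ c → After p → After c → Link p c
      parent-link p⊲c p-after c-after with edgeView p⊲c (grown⇒within (suc j) (d ∷ ds) c-after)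
      ... | along s x x<len = segment-link s (node-after⁻ s x<len c-after)
      ... | off {p} {c} ¬p-beyond ¬c-beyond =
        old p , old c , fwd (kept p~c (¬c-beyond ∘ splits⇒beyondBase p⊲c)) ,
        translate-off ¬p-beyond , translate-off ¬c-beyond
        where
        p~c : Shape._~_ S p c
        p~c = Before.edge⁺
          (⊲⇒~ p⊲c , from (off-segment ¬p-beyond) p-after , from (off-segment ¬c-beyond) c-after)

      link : ∀ {p q} → Restricted T After p q → Link p q
      link (p~q , p-after , q-after) with ~⇒⊲ p~q
      ... | inj₁ p⊲q = parent-link p⊲q p-after q-after
      ... | inj₂ q⊲p = link-sym (parent-link q⊲p q-after p-after)

      kept-adjacent : ∀ {p c} → p ⊲ c → Before c → ¬ Splits p c → translate p ~ translate c
      kept-adjacent p⊲c c-before ¬splits with edgeView p⊲c (grown⇒within (suc j) ds c-before)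
      ... | off ¬p-beyond ¬c-beyond =
        subst₂ _~_ (sym (translate-off ¬p-beyond)) (sym (translate-off ¬c-beyond)) (⊲⇒~ p⊲c)
      ... | along s x x<len = subst₂ _~_
        (sym (translate-unsplit s (<⇒≤ x<len) q≤x))
        (sym (translate-unsplit s x<len (m≤n⇒m≤1+n q≤x)))
        (⊲⇒~ (edge s (subst (_≤ len s) (stretch-≥ (m≤n⇒m≤1+n q≤x))
          (stretch≤len s (node-before⁻ s x<len c-before)))))
        where
        q≤x : quota s ≤ x
        q≤x = ≮⇒≥ (¬splits ∘ inj₁ ∘ toward-next s)

      edge-adjacent : ∀ {x y} → Edge x y → final translate x ~ final translate y
      edge-adjacent (kept u~v ¬splits) with Before.edge⁻ u~v
      ... | u~v′ , u-before , v-before with ~⇒⊲ u~v′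
      ...   | inj₁ u⊲v = kept-adjacent u⊲v v-before ¬splits
      ...   | inj₂ v⊲u = ~-sym (kept-adjacent v⊲u u-before (¬splits ∘ Sum.swap))
      edge-adjacent (grown (s , y , y<q , refl)) = subst₂ _~_
        (sym (translate-op s y<q))
        (sym (final-new s y<q))
        (⊲⇒~ (edge s (new≤len s y<q)))
      edge-adjacent (spliced u~v toward) with s , y , y<q , refl , refl ← toward⁻ toward = subst₂ _~_
        (sym (final-new s y<q))
        (sym (translate-next s y<q))
        (⊲⇒~ (edge s (subst (_≤ len s) (stretch-suc-≤ y<q)
          (stretch≤len s (node-present⁻ s (<quota⇒<len s y<q) (~-nodeʳ {S} u~v))))))

      edge-after : ∀ {x y} → Edge x y → Restricted T After (final translate x) (final translate y)
      edge-after {x} {y} e =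
        let x-present , y-present = edge-present ops e
        in edge-adjacent e , final-after x x-present , final-after y y-present

      link-after : ∀ {x y} → SymClosure Edge x y → Restricted T After (final translate x) (final translate y)
      link-after {x} {y} =
        gfold {S = Restricted T After} (restricted-sym {T} {After}) (final translate) edge-after {x} {y}

      body-at : ∀ {p} → After p → ∃[ x ] Present x × final translate x ≡ p
      body-at {p} p-after with position p
      ... | off ¬beyond = old p , Before.node⁺ (from (off-segment ¬beyond) p-after) , translate-off ¬beyond
      ... | beyond s x x<len =
        let _ , y , e , _ , y≡ = segment-link s (node-after⁻ s x<len p-after)
        in y , proj₂ (fold Product.swap (edge-present ops) e) , y≡

      doublingStep : Step u₀ S S′
      doublingStep = record
        { tree           = induced-tree S-before tree
        ; anchor         = Before.node⁺ (_ , start , inj₁ (s≤s z≤n))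
        ; ops            = ops
        ; move           = translate
        ; move-def       = λ {v} path → cong (v ⊕_) (sym (displacement≡δ path))
        ; collision-free = λ {x} {y} → pushesAhead⇒collision-free pushesAhead {x} {y}
        ; nodes′         = λ p → mk⇔ (body-at ∘ After.node⁻)
            λ { (x , x-present , refl) → After.node⁺ (final-after x x-present) }
        ; edges′         = λ p q → mk⇔ (link ∘ After.edge⁻)
            λ { (x , y , e , refl , refl) → After.edge⁺ (link-after {x} {y} e) }
        }

      doublingStep-fast : FastLineStep T u₀ (suc j) doublingStep
      doublingStep-fast = record
        { only-segments = λ { (s , y , y<q , refl) →
            base s , len s , segment s , ∈-base∷line⁺ (base s) d (<⇒≤ (<quota⇒<len s y<q)) }
        ; all-segments  = λ segment → operates (record { segment = segment })
        }
        where
        operates : ∀ s →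
          (∀ {u} → u ∈ Shape.nodes S → u ∈ base s ∷ line (base s) d (len s) → Op u) ⊎
          (∀ {u} → u ∈ line (base s) d (len s) → u ∈ Shape.nodes S′)
        operates s with full-or-complete (steps d ds) (len s)
        ... | inj₁ full     = inj₁ λ u∈S u∈s → operating u∈S (∈-base∷line⁻ (base s) d (len s) u∈s)
          where
          operating : ∀ {u} → u ∈ Shape.nodes S → ∃[ x ] x ≤ len s × u ≡ node s x → Op u
          operating u∈S (x , x≤len , refl) = s , x , subst (x <_) (sym full) (node-present⁻ s x≤len u∈S) , refl
        ... | inj₂ complete = inj₂ λ u∈s → present (∈-base∷line⁻ (base s) d (len s) (there u∈s))
          where
          present : ∀ {u} → ∃[ x ] x ≤ len s × u ≡ node s x → u ∈ Shape.nodes S′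
          present (x , x≤len , refl) = After.node⁺ (node-after⁺ s (subst (x <_) (sym complete) (s≤s x≤len)))

  -- Phases

  induced⇒grownUpTo : ∀ {i S} → Induced T (Within T u₀ i) S → GrownUpTo T u₀ i S
  induced⇒grownUpTo S-within = Induced.nodes⇔ S-within , Induced.edges⇔ S-within

  grown[]≐within : ∀ i → Grown (suc i) [] ≐ Within T u₀ i
  grown[]≐within i = ⇒within , λ (ps , p , segments≤i) → ps , p , inj₁ (s≤s segments≤i)
    where
    ⇒within : ∀ {v} → Grown (suc i) [] v → Within T u₀ i v
    ⇒within (ps , p , inj₁ (s≤s segments≤i))    = ps , p , segments≤i
    ⇒within (ps , p , inj₂ (segments≡ , length<1)) =
      contradiction (segments>0⇒lastLength>0 ps (subst (0 <_) (sym segments≡) (s≤s z≤n))) (<⇒≱ length<1)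

  grown≐within : ∀ i ds → (∀ d → size < 2 ^ steps d ds) → Grown i ds ≐ Within T u₀ i
  grown≐within i ds size<2^steps = grown⇒within i ds , within⇒
    where
    within⇒ : ∀ {v} → Within T u₀ i v → Grown i ds v
    within⇒ (ps , p , segments≤i) with m≤n⇒m<n∨m≡n segments≤i
    ... | inj₁ segments<i = ps , p , inj₁ segments<i
    ... | inj₂ segments≡i = ps , p , inj₂ (segments≡i ,
      ≤-<-trans (≤-trans (lastLength≤length ps) (path-length≤size u₀∈ p)) (size<2^steps (lastDir ps)))

  Finishes : ℕ → List Dir → ℕ → Set₁
  Finishes i ds t = ∀ S → Induced T (Grown i ds) S → ∃[ g ] Phase T u₀ i {S} {t} g

  finishes-step : ∀ {j d ds t} → Finishes (suc j) (d ∷ ds) t → Finishes (suc j) ds (suc t)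
  finishes-step {j} {d} {ds} finishes S S-grown =
    let open Doubling j d ds
        S′-grown  = stage-induced (suc j) (d ∷ ds)
        g , phase = finishes (stage (suc j) (d ∷ ds)) S′-grown
    in doublingStep S-grown S′-grown ∷ g , grow (doublingStep-fast S-grown S′-grown) phase

  finishes-steps : ∀ {j t} ds → Finishes (suc j) ds t → Finishes (suc j) [] (length ds + t)
  finishes-steps         []       finishes = finishes
  finishes-steps {j} {t} (d ∷ ds) finishes =
    subst (Finishes (suc j) []) (+-suc (length ds) t) (finishes-steps ds (finishes-step finishes))

  finishes-phase : ∀ {j ds t} → (∀ d → size < 2 ^ steps d ds) →
                   Finishes (2 + j) [] t → Finishes (suc j) [] (length ds + t)
  finishes-phase {j} {ds} size<2^steps finishes = finishes-steps ds λ S S-grown →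
    let S-within  = induced-resp-≐ S-grown (grown≐within (suc j) ds size<2^steps)
        g , phase = finishes S (induced-resp-≐ S-within (Product.swap (grown[]≐within (suc j))))
    in g , next (induced⇒grownUpTo S-within) phase

  finishes-phases : ∀ {ds} → (∀ d → size < 2 ^ steps d ds) →
                    ∀ n j → (∀ {v ps} → RootPath v ps → segments ps ≤ j + n) →
                    Finishes (suc j) [] (n * length ds)
  finishes-phases size<2^steps zero j segments≤j S S-grown =
    done (induced-by-all S-grown all-grown hasRootPath⇒node) , finish
    where
    all-grown : ∀ {v} → v ∈ nodes → Grown (suc j) [] v
    all-grown v∈ = let ps , p = path-to v∈ in
      ps , p , inj₁ (s≤s (subst (segments ps ≤_) (+-identityʳ j) (segments≤j p)))
  finishes-phases {ds} size<2^steps (suc n) j segments≤ =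
    finishes-phase {ds = ds} size<2^steps (finishes-phases {ds} size<2^steps n (suc j)
      λ {_} {ps} p → subst (segments ps ≤_) (+-suc j n) (segments≤ p))

  singleton-induced : Induced T (Within T u₀ 0) (singleton u₀)
  singleton-induced = record
    { nodes⇔ = λ p → mk⇔ (λ { (here refl) → _ , start , z≤n }) (here ∘ only-root)
    ; edges⇔ = λ p q → mk⇔ (λ ()) λ (p~q , p-within , q-within) →
        contradiction (trans (only-root p-within) (sym (only-root q-within))) (~-irrefl {T} p~q)
    }
    where
    only-root : ∀ {v} → Within T u₀ 0 v → v ≡ u₀
    only-root (_ , start , _) = refl
    only-root (_ , extend {ps = _ ∷ _} _ _ _ , ())

  bfs-grows : ∀ n → (∀ {v ps} → RootPath v ps → segments ps ≤ n) →
              ∃[ g ] BFSOnLineSegments T u₀ {n * (suc ⌊log₂ size ⌋ * 4)} g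
  bfs-grows n segments≤n = subst (λ t → ∃[ g ] BFSOnLineSegments T u₀ {n * t} g) (length-rounds (suc ⌊log₂ size ⌋))
    (finishes-phases {rounds (suc ⌊log₂ size ⌋)} size<2^steps n 0 segments≤n
      (singleton u₀) (induced-resp-≐ singleton-induced (Product.swap (grown[]≐within 0))))
    where
    size<2^steps : ∀ d → size < 2 ^ steps d (rounds (suc ⌊log₂ size ⌋))
    size<2^steps d =
      subst (λ s → size < 2 ^ s) (sym (steps-rounds d (suc ⌊log₂ size ⌋))) (n<2^[1+⌊log₂n⌋] size)

  leaf-below : ∀ {v ps} → RootPath v ps → ∃[ u ] ∃[ qs ] RootToLeaf T u₀ u qs × segments ps ≤ segments qs
  leaf-below = path-rec u₀∈ LeafBelow from-children
    where
    LeafBelow : Point → List Point → Set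
    LeafBelow _ ps = ∃[ u ] ∃[ qs ] RootToLeaf T u₀ u qs × segments ps ≤ segments qs
    from-children : ∀ {v ps} → RootPath v ps →
                    (∀ {w} → RootPath w (w ∷ ps) → LeafBelow w (w ∷ ps)) → LeafBelow v ps
    from-children {v} {ps} p below-child with any? (λ w → (v ~? w) ×-dec ¬? (w ∈? ps)) nodes
    ... | yes child =
      let w , _ , v~w , w∉ps = find child
          u , qs , leaf , segments≤ = below-child (extend p v~w w∉ps)
      in u , qs , leaf , ≤-trans (segments-∷ w ps) segments≤
    ... | no ¬child = v , ps , (p , closed) , ≤-refl
      where
      closed : ∀ w → v ~ w → w ∈ ps
      closed w v~w = decidable-stable (w ∈? ps) λ w∉ps → ¬child (lose (~-nodeʳ {T} v~w) (v~w , w∉ps))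

  segments≤leaf-turningPoints : ∀ {n} → (∀ {v ps} → RootToLeaf T u₀ v ps → turningPoints ps ≤ n) →
                                ∀ {v ps} → RootPath v ps → segments ps ≤ n
  segments≤leaf-turningPoints bound p =
    let _ , _ , leaf , segments≤ = leaf-below p in ≤-trans segments≤ (≤-trans pred[n]≤n (bound leaf))

  segments<size : ∀ {v ps} → RootPath v ps → segments ps < size
  segments<size {ps = p ∷ ps} path = <-≤-trans (segments<length p ps) (path-length≤size u₀∈ path)

  bfs-steps≤8m⌊log₂n⌋ : ∀ m → (∀ {v ps} → RootToLeaf T u₀ v ps → turningPoints ps ≤ m) →
    ∃[ t ] ∃[ g ] (BFSOnLineSegments T u₀ {t} g × t ≤ 8 * m * ⌊log₂ size ⌋)
  bfs-steps≤8m⌊log₂n⌋ m turns≤m with 2 ≤? size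
  ... | yes 2≤size =
    let g , bfs = bfs-grows m (segments≤leaf-turningPoints turns≤m) in _ , g , bfs , (begin
      m * (suc l * 4)      ≤⟨ *-monoʳ-≤ m (*-monoˡ-≤ 4 (+-monoˡ-≤ l (2≤n⇒1≤⌊log₂n⌋ 2≤size))) ⟩
      m * ((l + l) * 4)    ≡⟨ ring m l ⟩
      8 * m * l            ∎)
    where
    open ≤-Reasoning
    l : ℕ
    l = ⌊log₂ size ⌋
    ring : ∀ m l → m * ((l + l) * 4) ≡ 8 * m * l
    ring = ℕ-Solver.solve-∀
  ... | no 2≰size =
    let g , bfs = bfs-grows 0 (λ path → ≤-pred (<-≤-trans (segments<size path) (≤-pred (≰⇒> 2≰size))))
    in 0 , g , bfs , z≤n

theorem3p1 : ∀ (c : ℕ) → ∃[ C ]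
    (∀ (T : Shape) → IsTree T →
    ∀ (u₀ : Point) → u₀ ∈ Shape.nodes T →
    ∀ (k : ℕ) → (∀ {v ps} → RootToLeaf T u₀ v ps → turningPoints ps ≤ c * k) →
    ∃[ t ] ∃[ g ] (BFSOnLineSegments T u₀ {t} g × t ≤ C * (k * ⌊log₂ Shape.size T ⌋)))
theorem3p1 c = 8 * c , λ T tree u₀ u₀∈ k turns≤c*k →
  let t , g , bfs , t≤8*m*l = Tree.bfs-steps≤8m⌊log₂n⌋ T tree u₀ u₀∈ (c * k) turns≤c*k
  in t , g , bfs , subst (t ≤_) (reassociate c k ⌊log₂ Shape.size T ⌋) t≤8*m*l
  where
  reassociate : ∀ c k l → 8 * (c * k) * l ≡ 8 * c * (k * l)
  reassociate = ℕ-Solver.solve-∀
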